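{- There is an absolute constant $C>0$ such that for all integers $n\ge1$ and $0\le w\le n$ and every $\varepsilon\in(0,1)$, there is a symmetric torus polynomial $\{0,1\}^n\to\mathbb{T}$ of degree at most $\frac{C(\log(n/\varepsilon))^{C}}{\varepsilon}$ that $\varepsilon$-approximates $\Delta_w$; and thus $$\overline{\deg}_\varepsilon(\Delta_w)\le\frac{C(\log(n/\varepsilon))^{C}}{\varepsilon}.$$
   Context: Logarithms are base 2. Let $\mathbb{T}=\mathbb{R}/\mathbb{Z}$. For $z\in\mathbb{T}$, $|z \bmod 1|$ denotes $|\iota(z)|$, where $\iota(z)$ is the unique representative of $z$ in $[-1/2,1/2)$. For $F:\{0,1\}^n\to\mathbb{T}$, $\|F \bmod 1\|_\infty=\max_{x\in\{0,1\}^n}|F(x)\bmod 1|$. A torus polynomial of degree (at most) $d$ is a function $P:\{0,1\}^n\to\mathbb{T}$ of the form $P(x)=\sum_{S\subseteq[n],|S|\le d}P_S\prod_{i\in S}x_i \bmod 1$ with $P_S\in\mathbb{R}$. It is symmetric if it is given by a symmetric real polynomial of degree at most $d$ evaluated modulo one (i.e. the coefficients $P_S$ can be taken to depend only on $|S|$). It $\varepsilon$-approximates $f:\{0,1\}^n\to\{0,1\}$ if $\|P-\tfrac{f}{2}\bmod 1\|_\infty\le\varepsilon$. The toroidal $\varepsilon$-approximation degree $\overline{\deg}_\varepsilon(f)$ is the minimal $d\ge0$ for which a torus polynomial of degree $d$ that $\varepsilon$-approximates $f$ exists. For $x\in\{0,1\}^n$, $|x|=\sum_i x_i$. For $0\le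 w\le n$, $\Delta_w:\{0,1\}^n\to\{0,1\}$ is defined by $\Delta_w(x)=1$ if $|x|=w$ and $0$ otherwise. -}

module Defs where

open import Level using (0ℓ)
open import Algebra.Bundles using (CommutativeRing)
open import Axiom.ExcludedMiddle using (ExcludedMiddle)
open import Data.Bool.Base using (Bool; true; false; if_then_else_)
open import Data.Fin.Subset using (Subset; inside; outside; ∣_∣)
open import Data.Integer.Base using (ℤ; +_; -[1+_])
open import Data.List.Base using (List; []; _∷_; _++_; map; filter; foldr)
open import Data.Nat.Base as ℕ using (ℕ; suc)
import Data.Nat.Properties as ℕ
open import Data.Product.Base using (∃; ∃-syntax; _×_; _,_; proj₁)
open import Data.Rational.Base using (ℚ; ↥_; ↧ₙ_)
open import Data.Vec.Base using ([]; _∷_)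
open import Relation.Binary.Bundles using (TotalOrder)
open import Relation.Binary.PropositionalEquality.Core using (_≡_)
open import Relation.Binary.Structures using (IsTotalOrder)
open import Relation.Nullary.Decidable.Core using (yes; no; does)
open import Relation.Nullary.Negation.Core using (¬_)

-- The real numbers, as a Dedekind-complete ordered field (unique up to
-- isomorphism).  Equality is the setoid equality of the underlying ring.

record CompleteOrderedField : Set₁ where
  infix  4 _≤_
  infix 10 _⁻¹
  field
    commutativeRing : CommutativeRing 0ℓ 0ℓ

  open CommutativeRing commutativeRing

  field
    0≉1          : ¬ (0# ≈ 1#)
    _⁻¹          : Carrier → Carrier   -- no value is prescribed at 0
    ⁻¹-cong      : ∀ {x y} → x ≈ y → x ⁻¹ ≈ y ⁻¹
    *-inverseʳ   : ∀ x → ¬ (x ≈ 0#) → x * x ⁻¹ ≈ 1#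
    _≤_          : Carrier → Carrier → Set
    isTotalOrder : IsTotalOrder _≈_ _≤_
    +-monoˡ-≤    : ∀ z {x y} → x ≤ y → x + z ≤ y + z
    *-nonNeg     : ∀ {x y} → 0# ≤ x → 0# ≤ y → 0# ≤ x * y

  IsUpperBound : (Carrier → Set) → Carrier → Set
  IsUpperBound S u = ∀ x → S x → x ≤ u

  IsSupremum : (Carrier → Set) → Carrier → Set
  IsSupremum S s = IsUpperBound S s × (∀ u → IsUpperBound S u → s ≤ u)

  field
    complete : ∀ (S : Carrier → Set) → ∃ S → ∃ (IsUpperBound S) → ∃ (IsSupremum S)

cube : ∀ n → List (Subset n)
cube 0       = [] ∷ []
cube (suc n) = map (outside ∷_) (cube n) ++ map (inside ∷_) (cube n)

-- The point x of {0,1}ⁿ is identified with the subset { i | xᵢ = 1 } of [n];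
-- its weight |x| is the cardinality ∣ x ∣.

Cube : ℕ → Set
Cube = Subset

Δ : ∀ {n} → ℕ → Cube n → Bool
Δ w x = does (∣ x ∣ ℕ.≟ w)

-- Excluded middle, used to define the partial operations on reals below,
-- is an explicit parameter: the reals here are the classical ones.

module Torus (em : ExcludedMiddle 0ℓ) (R : CompleteOrderedField) where

  open CompleteOrderedField R public
  open CommutativeRing commutativeRing public
    using (_≈_; _+_; _*_; -_; _-_; 0#; 1#; semiring; +-rawMonoid)
    renaming (Carrier to ℝ)
  open import Algebra.Definitions.RawMonoid +-rawMonoid using () renaming (_×_ to _·_)
  open import Algebra.Properties.Semiring.Exp semiring public using (_^_)
  open import Relation.Binary.Construct.NonStrictToStrict _≈_ _≤_ public using (_<_)

  totalOrder : TotalOrder 0ℓ 0ℓ 0ℓ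
  totalOrder = record { isTotalOrder = isTotalOrder }

  open import Algebra.Construct.NaturalChoice.Max totalOrder public using (_⊔_)
  open import Data.List.Extrema totalOrder public using (max)

  infixl 7 _/_
  _/_ : ℝ → ℝ → ℝ
  x / y = x * y ⁻¹

  fromℕ : ℕ → ℝ
  fromℕ n = n · 1#

  fromℤ : ℤ → ℝ
  fromℤ (+ n)    = fromℕ n
  fromℤ -[1+ n ] = - fromℕ (suc n)

  fromℚ : ℚ → ℝ
  fromℚ r = fromℤ (↥ r) / fromℕ (↧ₙ r)

  fromBool : Bool → ℝ
  fromBool b = if b then 1# else 0#

  abs : ℝ → ℝ
  abs x = x ⊔ (- x)

  ½ : ℝ
  ½ = 1# / fromℕ 2

  -- The supremum of a nonempty set that is bounded above; 0 otherwise.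
  sup : (ℝ → Set) → ℝ
  sup S with em {∃ S × ∃ (IsUpperBound S)}
  ... | yes (nonempty , bounded) = proj₁ (complete S nonempty bounded)
  ... | no  _                    = 0#

  2^ℤ : ℤ → ℝ
  2^ℤ (+ n)    = fromℕ 2 ^ n
  2^ℤ -[1+ n ] = (fromℕ 2 ^ suc n) ⁻¹

  -- z = 2 ^ r for rational r = p / q: the nonnegative q-th root of 2 ^ p.
  Is2^ℚ : ℚ → ℝ → Set
  Is2^ℚ r z = 0# ≤ z × z ^ (↧ₙ r) ≈ 2^ℤ (↥ r)

  -- 2 ^ y = sup { 2 ^ r | r rational, r ≤ y }
  exp₂ : ℝ → ℝ
  exp₂ y = sup (λ z → ∃[ r ] (fromℚ r ≤ y × Is2^ℚ r z))

  -- The inverse of the increasing continuous bijection exp₂ from the reals to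
  -- the positive reals; meaningful for x > 0 only.
  log₂ : ℝ → ℝ
  log₂ x = sup (λ y → exp₂ y ≤ x)

  -- The real power x ^ c, for x > 0.
  pow : ℝ → ℝ → ℝ
  pow x c = exp₂ (c * log₂ x)

  -- Elements of 𝕋 = ℝ/ℤ are given by real representatives, so torus-valued
  -- functions are real-valued functions considered up to _≡₁_.
  𝕋 : Set
  𝕋 = ℝ

  infix 4 _≡₁_
  _≡₁_ : 𝕋 → 𝕋 → Set
  x ≡₁ y = ∃[ k ] (x - y ≈ fromℤ k)

  -- The representative in [-1/2, 1/2).  Such a k exists for every z because the
  -- field is Archimedean, so the second case never occurs.
  ι : 𝕋 → ℝ
  ι z with em {∃[ k ] (- ½ ≤ z - fromℤ k × z - fromℤ k < ½)}
  ... | yes (k , _) = z - fromℤ k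
  ... | no  _       = 0#

  ∣_mod1∣ : 𝕋 → ℝ
  ∣ z mod1∣ = abs (ι z)

  -- The entries are nonnegative, so the base value 0 does not affect the maximum.
  ‖_mod1‖∞ : ∀ {n} → (Cube n → 𝕋) → ℝ
  ‖_mod1‖∞ {n} F = max 0# (map (λ x → ∣ F x mod1∣) (cube n))

  -- ∏ i ∈ S, xᵢ
  monomial : ∀ {n} → Subset n → Cube n → ℝ
  monomial []            []      = 1#
  monomial (inside  ∷ S) (b ∷ x) = fromBool b * monomial S x
  monomial (outside ∷ S) (b ∷ x) = monomial S x

  sum : List ℝ → ℝ
  sum = foldr _+_ 0#

  evalPoly : ∀ {n} → ℕ → (Subset n → ℝ) → Cube n → ℝ
  evalPoly {n} d c x =
    sum (map (λ S → c S * monomial S x) (filter (λ S → ∣ S ∣ ℕ.≤? d) (cube n)))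

  -- In both predicates "degree d" means degree at most d.
  IsTorusPolynomial : ∀ {n} → ℕ → (Cube n → 𝕋) → Set
  IsTorusPolynomial d P = ∃[ c ] (∀ x → P x ≡₁ evalPoly d c x)

  IsSymmetricTorusPolynomial : ∀ {n} → ℕ → (Cube n → 𝕋) → Set
  IsSymmetricTorusPolynomial d P =
    ∃[ c ] ((∀ S T → ∣ S ∣ ≡ ∣ T ∣ → c S ≈ c T) × (∀ x → P x ≡₁ evalPoly d c x))

  Approximates : ∀ {n} → ℝ → (Cube n → 𝕋) → (Cube n → Bool) → Set
  Approximates ε P f = ‖ (λ x → P x - fromBool (f x) / fromℕ 2) mod1‖∞ ≤ ε

  HasApproximation : ∀ {n} → ℝ → (Cube n → Bool) → ℕ → Set
  HasApproximation {n} ε f d =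
    ∃[ P ] (IsTorusPolynomial {n} d P × Approximates ε P f)

  -- d is the toroidal ε-approximation degree of f.
  IsToroidalDegree : ∀ {n} → ℝ → (Cube n → Bool) → ℕ → Set
  IsToroidalDegree ε f d =
    HasApproximation ε f d × (∀ d′ → HasApproximation ε f d′ → d ℕ.≤ d′)

  degreeBound : ℝ → ℕ → ℝ → ℝ
  degreeBound C n ε = C * pow (log₂ (fromℕ n / ε)) C / ε

{-# OPTIONS --safe #-}
-- Call q ≤ D fresh if lcm(1, …, q) ≠ lcm(1, …, q − 1).  Each jump multiplies the
-- lcm by at most D, and lcm(1, …, D) ≥ 2^(D − 1) by the Leibniz harmonic triangle
-- (Nair), so there are T ≥ (D − 1)/log D fresh numbers.  On the other hand
-- a nonzero integer of size at most n has at most log n fresh divisors, since each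
-- one at least doubles the lcm of the smaller ones.  Hence the average over fresh q
-- of the indicators [q ∣ |x| − w] is 1 if |x| = w and at most (log n)/T otherwise.
--
-- A fresh q is a prime power pᵅ, and modulo p the indicator [q ∣ z] is the
-- polynomial C(z − 1, q − 1), of degree q − 1.  Modulus amplification
-- f ↦ 1 − (1 − fᵏ)ᵏ turns this congruence into one modulo pᵏ at the cost of
-- a factor k² in the degree.  Multiplied by ⌊pᵏ/2T⌋/pᵏ it agrees modulo 1 with
-- [q ∣ z]/2T up to 2⁻ᵏ, and the sum over q approximates Δ_w/2.  With D ≈ (log n)²/ε
-- up to constants and k ≈ log(n/ε) the degree is polylog(n/ε)/ε.  For ε ≥ 1/4 the
-- constant 1/4 is an approximation of degree 0.
module Submission where

open import Defs
open import Level using (0ℓ)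
open import Algebra.Bundles using (CommutativeRing)
open import Axiom.ExcludedMiddle using (ExcludedMiddle)
open import Data.Bool.Base using (Bool; true; false)
open import Data.Empty using (⊥-elim)
open import Data.Integer.Base as ℤ using (ℤ; +_; -[1+_]; 0ℤ; 1ℤ)
import Data.Integer.Properties as ℤ
import Data.Integer.Tactic.RingSolver as ℤ-Solver
open import Data.List.Base using (List; []; _∷_; _++_; length; map; filter)
open import Data.List.Properties using (map-++; map-∘)
import Data.List.Relation.Unary.All as All
import Data.List.Relation.Unary.All.Properties as All
import Data.Maybe.Base as Maybe
open import Data.Nat.Base as ℕ using (ℕ; zero; suc)
import Data.Nat.Coprimality as Coprime
import Data.Nat.Properties as ℕ
open import Data.Product.Base using (∃; ∃-syntax; _×_; _,_; proj₁; proj₂)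
open import Data.Sum.Base using (_⊎_; inj₁; inj₂)
open import Relation.Binary.Bundles using (TotalOrder)
open import Relation.Binary.Consequences using (dec⇒weaklyDec)
import Relation.Binary.PropositionalEquality as ≡
open ≡ using (_≡_)
import Relation.Binary.Reasoning.Setoid as SetoidReasoning
open import Relation.Nullary
open import Relation.Nullary.Decidable using (decidable-stable)

module Arithmetic where
  open import Data.Nat.Base
  open import Data.Nat.Combinatorics using (_C_; nCk≡nC[n∸k]; nCk+nC[k+1]≡[n+1]C[k+1]; k>n⇒nCk≡0; nCn≡1)
  open import Data.Nat.Coprimality using (Coprime; coprime-divisor)
  open import Data.Nat.DivMod using (m≡m%n+[m/n]*n; m%n<n; m/n*n≤m)
  open import Data.Nat.Divisibility
  open import Data.Nat.GCD using (gcd)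
  open import Data.Nat.Induction using (<-wellFounded; Acc; acc)
  open import Data.Nat.LCM using (lcm; m∣lcm[m,n]; n∣lcm[m,n]; lcm-least; gcd*lcm)
  open import Data.Nat.ListAction using (product)
  open import Data.Nat.Primality using (Prime; prime⇒nonZero; prime⇒nonTrivial; prime⇒irreducible)
  open import Data.Nat.Primality.Factorisation using (factorise)
  open import Data.Nat.Properties
  open import Data.Nat.Tactic.RingSolver using (solve-∀)
  open import Relation.Binary.PropositionalEquality

  -- Binomial coefficients.

  nC0≡1 : ∀ n → n C 0 ≡ 1
  nC0≡1 n = trans (nCk≡nC[n∸k] (z≤n {n})) (nCn≡1 n)

  -- The absorption identity, from two uses of Pascal's rule. It makes binomial coefficients
  -- nonzero, relates neighbours in the harmonic triangle, and shows that p divides the inner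
  -- binomial coefficients of q.
  [1+k]*[1+n]C[1+k]≡[1+n]*nCk : ∀ n k → suc k * (suc n C suc k) ≡ suc n * (n C k)
  [1+k]*[1+n]C[1+k]≡[1+n]*nCk zero zero = refl
  [1+k]*[1+n]C[1+k]≡[1+n]*nCk zero (suc k) = begin
    suc (suc k) * (1 C suc (suc k)) ≡⟨ cong (suc (suc k) *_) (k>n⇒nCk≡0 {1} {2 + k} (s≤s (s≤s z≤n))) ⟩
    suc (suc k) * 0                 ≡⟨ *-zeroʳ (suc (suc k)) ⟩
    0                               ≡⟨ cong (1 *_) (k>n⇒nCk≡0 {0} {suc k} (s≤s z≤n)) ⟨
    1 * (0 C suc k)                 ∎
    where open ≡-Reasoning
  [1+k]*[1+n]C[1+k]≡[1+n]*nCk (suc n) zero = begin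
    1 * (suc (suc n) C 1)                 ≡⟨ cong (1 *_) (nCk+nC[k+1]≡[n+1]C[k+1] (suc n) 0) ⟨
    1 * ((suc n C 0) + (suc n C 1))       ≡⟨ cong (1 *_) (cong₂ _+_ (nC0≡1 (suc n)) refl) ⟩
    1 * (1 + (suc n C 1))                 ≡⟨ *-distribˡ-+ 1 1 (suc n C 1) ⟩
    1 + 1 * (suc n C 1)                   ≡⟨ cong suc ([1+k]*[1+n]C[1+k]≡[1+n]*nCk n 0) ⟩
    1 + suc n * (n C 0)                   ≡⟨ cong (λ x → 1 + suc n * x) (nC0≡1 n) ⟩
    suc (suc n) * 1                       ≡⟨ cong (suc (suc n) *_) (nC0≡1 (suc n)) ⟨
    suc (suc n) * (suc n C 0)             ∎
    where open ≡-Reasoning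
  [1+k]*[1+n]C[1+k]≡[1+n]*nCk (suc n) (suc k) = begin
    (2 + k) * (suc (suc n) C suc (suc k))
      ≡⟨ cong ((2 + k) *_) (nCk+nC[k+1]≡[n+1]C[k+1] (suc n) (suc k)) ⟨
    (2 + k) * (a + b)
      ≡⟨ expand k a b ⟩
    a + (suc k * a + (2 + k) * b)
      ≡⟨ cong (λ t → a + t) (cong₂ _+_ ([1+k]*[1+n]C[1+k]≡[1+n]*nCk n k) ([1+k]*[1+n]C[1+k]≡[1+n]*nCk n (suc k))) ⟩
    a + (suc n * (n C k) + suc n * (n C suc k))
      ≡⟨ cong (λ t → a + t) (*-distribˡ-+ (suc n) (n C k) (n C suc k)) ⟨
    a + suc n * ((n C k) + (n C suc k))
      ≡⟨ cong (λ x → a + suc n * x) (nCk+nC[k+1]≡[n+1]C[k+1] n k) ⟩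
    suc (suc n) * a ∎
    where
    open ≡-Reasoning
    a = suc n C suc k
    b = suc n C suc (suc k)
    expand : ∀ k a b → (2 + k) * (a + b) ≡ a + (suc k * a + (2 + k) * b)
    expand = solve-∀

  nCk≢0 : ∀ {n k} → k ≤ n → NonZero (n C k)
  nCk≢0 {n} {zero} _ = subst NonZero (sym (nC0≡1 n)) _
  nCk≢0 {suc n} {suc k} (s≤s k≤n) = ≢-nonZero λ eq →
    let instance _ = nCk≢0 k≤n in
    1+n≢0 (m*n≡0⇒m≡0 (suc n) (n C k) (trans (sym ([1+k]*[1+n]C[1+k]≡[1+n]*nCk n k)) (trans (cong (suc k *_) eq) (*-zeroʳ (suc k)))))

  -- Nair's lower bound on lcm(1, ..., n).

  lcm[1‥_] : ℕ → ℕ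
  lcm[1‥ zero ]  = 1
  lcm[1‥ suc j ] = lcm lcm[1‥ j ] (suc j)

  lcm≢0 : ∀ m n → .{{NonZero m}} → .{{NonZero n}} → NonZero (lcm m n)
  lcm≢0 m n = ≢-nonZero λ eq → ≢-nonZero⁻¹ (m * n) {{m*n≢0 m n}}
    (trans (sym (gcd*lcm m n)) (trans (cong (gcd m n *_) eq) (*-zeroʳ (gcd m n))))

  lcm≤* : ∀ m n → .{{NonZero m}} → .{{NonZero n}} → lcm m n ≤ m * n
  lcm≤* m n = ∣⇒≤ {{m*n≢0 m n}} (lcm-least {m} {n} (m∣m*n n) (n∣m*n m))

  lcm[1‥j]≢0 : ∀ j → NonZero lcm[1‥ j ]
  lcm[1‥j]≢0 zero    = _
  lcm[1‥j]≢0 (suc j) = lcm≢0 lcm[1‥ j ] (suc j) {{lcm[1‥j]≢0 j}}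

  ≤⇒∣lcm[1‥] : ∀ {i j} → 0 < i → i ≤ j → i ∣ lcm[1‥ j ]
  ≤⇒∣lcm[1‥] {j = zero} i>0 i≤0 = ⊥-elim (<⇒≱ i>0 i≤0)
  ≤⇒∣lcm[1‥] {i} {suc j} i>0 i≤j with m≤n⇒m<n∨m≡n i≤j
  ... | inj₁ (s≤s i≤j′) = ∣-trans (≤⇒∣lcm[1‥] i>0 i≤j′) (m∣lcm[m,n] lcm[1‥ j ] (suc j))
  ... | inj₂ refl       = n∣lcm[m,n] lcm[1‥ j ] (suc j)

  -- 1/b + 1/c = 1/a, so L/b = L/a − L/c is an integer as soon as L/a and L/c are.
  harmonic-∣ : ∀ {a b c L} → .{{NonZero a}} → .{{NonZero c}} →
               b * c ≡ a * b + a * c → a ∣ L → c ∣ L → b ∣ L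
  harmonic-∣ {a} {b} {c} {L} bc≡ab+ac (divides x L≡xa) (divides y L≡yc) =
    ∣m+n∣m⇒∣n (divides x (sym xb≡)) (n∣m*n y)
    where
    regroup : ∀ a b c x → a * c * (x * b) ≡ (b * c) * (x * a)
    regroup = solve-∀
    regroup′ : ∀ a b c y L → a * c * (y * b + L) ≡ a * b * (y * c) + a * c * L
    regroup′ = solve-∀
    xb≡ : x * b ≡ y * b + L
    xb≡ = *-cancelˡ-≡ _ _ (a * c) {{m*n≢0 a c}} (begin
      a * c * (x * b)             ≡⟨ regroup a b c x ⟩
      (b * c) * (x * a)           ≡⟨ cong₂ _*_ bc≡ab+ac (sym L≡xa) ⟩
      (a * b + a * c) * L         ≡⟨ *-distribʳ-+ L (a * b) (a * c) ⟩
      a * b * L + a * c * L       ≡⟨ cong (λ l → a * b * l + a * c * L) L≡yc ⟩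
      a * b * (y * c) + a * c * L ≡⟨ regroup′ a b c y L ⟨
      a * c * (y * b + L)         ∎)
      where open ≡-Reasoning

  -- The Leibniz harmonic triangle.
  [1+n]*nCk∣lcm : ∀ n k → k ≤ n → suc n * (n C k) ∣ lcm[1‥ suc n ]
  [1+n]*nCk∣lcm n zero _ =
    subst (_∣ lcm[1‥ suc n ]) (sym (trans (cong (suc n *_) (nC0≡1 n)) (*-identityʳ (suc n))))
      (n∣lcm[m,n] lcm[1‥ n ] (suc n))
  [1+n]*nCk∣lcm (suc n) (suc k) (s≤s k≤n) =
    harmonic-∣ {{m*n≢0 (suc n) (n C k) {{_}} {{nCk≢0 k≤n}}}} {{m*n≢0 (2 + n) (suc n C k) {{_}} {{nCk≢0 (m≤n⇒m≤1+n k≤n)}}}}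
      identity
      (∣-trans ([1+n]*nCk∣lcm n k k≤n) (m∣lcm[m,n] lcm[1‥ suc n ] (2 + n)))
      ([1+n]*nCk∣lcm (suc n) k (m≤n⇒m≤1+n k≤n))
    where
    a′ = n C k
    b′ = suc n C suc k
    c′ = suc n C k
    regroup : ∀ n a′ b′ c′ → suc n * a′ * ((2 + n) * b′) + suc n * a′ * ((2 + n) * c′)
                            ≡ (2 + n) * (suc n * a′ * (c′ + b′))
    regroup = solve-∀
    regroup′ : ∀ n k b′ d → (2 + n) * (suc k * b′ * d) ≡ (2 + n) * b′ * (suc k * d)
    regroup′ = solve-∀
    -- This is 1/a = 1/b + 1/c between an entry of the triangle and the two below it: Pascal's rule
    -- merges c′ + b′ into C(n + 2, k + 1), and absorption is applied twice.
    identity : (2 + n) * b′ * ((2 + n) * c′) ≡ suc n * a′ * ((2 + n) * b′) + suc n * a′ * ((2 + n) * c′)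
    identity = sym (begin
      suc n * a′ * ((2 + n) * b′) + suc n * a′ * ((2 + n) * c′) ≡⟨ regroup n a′ b′ c′ ⟩
      (2 + n) * (suc n * a′ * (c′ + b′))
        ≡⟨ cong₂ (λ u v → (2 + n) * (u * v)) (sym ([1+k]*[1+n]C[1+k]≡[1+n]*nCk n k)) (nCk+nC[k+1]≡[n+1]C[k+1] (suc n) k) ⟩
      (2 + n) * (suc k * b′ * (suc (suc n) C suc k)) ≡⟨ regroup′ n k b′ (suc (suc n) C suc k) ⟩
      (2 + n) * b′ * (suc k * (suc (suc n) C suc k)) ≡⟨ cong ((2 + n) * b′ *_) ([1+k]*[1+n]C[1+k]≡[1+n]*nCk (suc n) k) ⟩
      (2 + n) * b′ * ((2 + n) * c′) ∎)
      where open ≡-Reasoning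

  ∑C : ℕ → ℕ → ℕ
  ∑C n zero    = 0
  ∑C n (suc j) = ∑C n j + n C j

  ∑C-Pascal : ∀ n j → ∑C (suc n) (suc j) ≡ ∑C n (suc j) + ∑C n j
  ∑C-Pascal n zero = trans (nC0≡1 (suc n)) (sym (trans (+-identityʳ (n C 0)) (nC0≡1 n)))
  ∑C-Pascal n (suc j) = begin
    ∑C (suc n) (suc j) + suc n C suc j
      ≡⟨ cong₂ _+_ (∑C-Pascal n j) (sym (nCk+nC[k+1]≡[n+1]C[k+1] n j)) ⟩
    (∑C n (suc j) + ∑C n j) + (n C j + n C suc j)
      ≡⟨ regroup (∑C n (suc j)) (∑C n j) (n C j) (n C suc j) ⟩
    (∑C n (suc j) + n C suc j) + (∑C n j + n C j) ∎
    where
    open ≡-Reasoning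
    regroup : ∀ a b c d → (a + b) + (c + d) ≡ (a + d) + (b + c)
    regroup = solve-∀

  ∑C≡2^n : ∀ n → ∑C n (suc n) ≡ 2 ^ n
  ∑C≡2^n zero = refl
  ∑C≡2^n (suc n) = begin
    ∑C (suc n) (suc (suc n))                      ≡⟨ ∑C-Pascal n (suc n) ⟩
    (∑C n (suc n) + n C suc n) + ∑C n (suc n)     ≡⟨ cong (λ x → (∑C n (suc n) + x) + ∑C n (suc n)) (k>n⇒nCk≡0 (n<1+n n)) ⟩
    (∑C n (suc n) + 0) + ∑C n (suc n)             ≡⟨ cong (λ x → (x + 0) + x) (∑C≡2^n n) ⟩
    (2 ^ n + 0) + 2 ^ n                           ≡⟨ +-comm (2 ^ n + 0) (2 ^ n) ⟩
    2 ^ suc n                                     ∎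
    where open ≡-Reasoning

  -- Each summand (n + 1) C(n, i) divides the lcm, hence is at most the lcm. For j = n + 1 the row
  -- sum is 2^n, and the factor n + 1 cancels.
  [1+n]*∑C≤ : ∀ n j → j ≤ suc n → suc n * ∑C n j ≤ j * lcm[1‥ suc n ]
  [1+n]*∑C≤ n zero _ = ≤-reflexive (*-zeroʳ (suc n))
  [1+n]*∑C≤ n (suc j) (s≤s j≤n) = begin
    suc n * (∑C n j + n C j)           ≡⟨ *-distribˡ-+ (suc n) (∑C n j) (n C j) ⟩
    suc n * ∑C n j + suc n * (n C j)   ≤⟨ +-mono-≤ ([1+n]*∑C≤ n j (m≤n⇒m≤1+n j≤n))
                                            (∣⇒≤ {{lcm[1‥j]≢0 (suc n)}} ([1+n]*nCk∣lcm n j j≤n)) ⟩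
    j * L + L                          ≡⟨ +-comm (j * L) L ⟩
    suc j * L                          ∎
    where
    open ≤-Reasoning
    L = lcm[1‥ suc n ]

  2^n≤lcm[1‥1+n] : ∀ n → 2 ^ n ≤ lcm[1‥ suc n ]
  2^n≤lcm[1‥1+n] n = *-cancelˡ-≤ (suc n)
    (subst (λ s → suc n * s ≤ suc n * lcm[1‥ suc n ]) (∑C≡2^n n) ([1+n]*∑C≤ n (suc n) ≤-refl))

  -- Fresh numbers: many up to D, few among the divisors of a small integer.

  -- The j at which lcm[1‥_] jumps, in decreasing order; all of them are prime powers.
  fresh : ℕ → List ℕ
  fresh zero = []
  fresh (suc j) with suc j ∣? lcm[1‥ j ]
  ... | yes _ = fresh j
  ... | no  _ = suc j ∷ fresh j

  length-fresh : ∀ j → length (fresh j) ≤ j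
  length-fresh zero = z≤n
  length-fresh (suc j) with suc j ∣? lcm[1‥ j ]
  ... | yes _ = m≤n⇒m≤1+n (length-fresh j)
  ... | no  _ = s≤s (length-fresh j)

  -- A fresh j multiplies the lcm by at most j, any other j leaves it unchanged. The base X is
  -- separate from j so that it stays fixed along the induction.
  lcm[1‥]≤^fresh : ∀ {X} j → .{{NonZero X}} → j ≤ X → lcm[1‥ j ] ≤ X ^ length (fresh j)
  lcm[1‥]≤^fresh zero _ = ≤-refl
  lcm[1‥]≤^fresh {X} (suc j) j<X with suc j ∣? lcm[1‥ j ]
  ... | yes 1+j∣ = ≤-trans (∣⇒≤ {{lcm[1‥j]≢0 j}} (lcm-least ∣-refl 1+j∣)) (lcm[1‥]≤^fresh j (<⇒≤ j<X))
  ... | no  _ = begin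
    lcm lcm[1‥ j ] (suc j)        ≤⟨ lcm≤* lcm[1‥ j ] (suc j) {{lcm[1‥j]≢0 j}} ⟩
    lcm[1‥ j ] * suc j            ≤⟨ *-mono-≤ (lcm[1‥]≤^fresh j (<⇒≤ j<X)) j<X ⟩
    X ^ length (fresh j) * X      ≡⟨ *-comm (X ^ length (fresh j)) X ⟩
    X ^ suc (length (fresh j))    ∎
    where open ≤-Reasoning

  -- Otherwise the two bounds on lcm(1, ..., n + 1) contradict each other. Here ℓ is any integer
  -- upper bound for log(n + 1).
  n≤ℓ*#fresh : ∀ n ℓ → suc n ≤ 2 ^ ℓ → n ≤ ℓ * length (fresh (suc n))
  n≤ℓ*#fresh n ℓ n<2^ℓ = ≮⇒≥ λ <n → <⇒≱ (^-monoʳ-< 2 (s≤s (s≤s z≤n)) <n) (begin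
    2 ^ n                               ≤⟨ 2^n≤lcm[1‥1+n] n ⟩
    lcm[1‥ suc n ]                      ≤⟨ lcm[1‥]≤^fresh {2 ^ ℓ} (suc n) {{m^n≢0 2 ℓ}} n<2^ℓ ⟩
    (2 ^ ℓ) ^ length (fresh (suc n))    ≡⟨ ^-*-assoc 2 ℓ (length (fresh (suc n))) ⟩
    2 ^ (ℓ * length (fresh (suc n)))    ∎)
    where open ≤-Reasoning

  ⟦_∣_⟧ : ℕ → ℕ → ℕ
  ⟦ q ∣ m ⟧ with q ∣? m
  ... | yes _ = 1
  ... | no  _ = 0

  #divisors : List ℕ → ℕ → ℕ
  #divisors []       m = 0
  #divisors (q ∷ qs) m = ⟦ q ∣ m ⟧ + #divisors qs m

  2*≤proper : ∀ {c d} → .{{NonZero d}} → c ∣ d → c ≢ d → 2 * c ≤ d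
  2*≤proper (divides zero d≡0) _ = ⊥-elim (≢-nonZero⁻¹ _ d≡0)
  2*≤proper {c} (divides 1 d≡c) c≢d = ⊥-elim (c≢d (sym (trans d≡c (*-identityˡ c))))
  2*≤proper {c} (divides (suc (suc k)) d≡) _ = ≤-trans (*-monoˡ-≤ c (s≤s (s≤s (z≤n {k})))) (≤-reflexive (sym d≡))

  -- The witness is the lcm of the fresh divisors of m; each of them at least doubles it.
  2^#fresh-divisors≤ : ∀ {m} → .{{NonZero m}} → ∀ j →
    ∃[ c ] (NonZero c × c ∣ m × c ∣ lcm[1‥ j ] × 2 ^ #divisors (fresh j) m ≤ c)
  2^#fresh-divisors≤ zero = 1 , _ , 1∣ _ , ∣-refl , ≤-refl
  2^#fresh-divisors≤ {m} (suc j) with suc j ∣? lcm[1‥ j ] | 2^#fresh-divisors≤ {m} j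
  ... | yes _ | c , c≢0 , c∣m , c∣L , ≤c = c , c≢0 , c∣m , ∣-trans c∣L (m∣lcm[m,n] lcm[1‥ j ] (suc j)) , ≤c
  ... | no 1+j∤L | c , c≢0 , c∣m , c∣L , ≤c with suc j ∣? m
  ...   | no _ = c , c≢0 , c∣m , ∣-trans c∣L (m∣lcm[m,n] lcm[1‥ j ] (suc j)) , ≤c
  ...   | yes 1+j∣m = lcm c (suc j) , lcm≢0 c (suc j) {{c≢0}} , lcm-least c∣m 1+j∣m ,
    lcm-least (∣-trans c∣L (m∣lcm[m,n] lcm[1‥ j ] (suc j))) (n∣lcm[m,n] lcm[1‥ j ] (suc j)) ,
    -- The new lcm differs from c, since otherwise `suc j` would divide c and so `lcm[1‥ j ]`. The
    -- invariant c ∣ `lcm[1‥ j ]` is carried for this.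
    ≤-trans (*-monoʳ-≤ 2 ≤c) (2*≤proper {{lcm≢0 c (suc j) {{c≢0}}}} (m∣lcm[m,n] c (suc j))
      λ c≡ → 1+j∤L (∣-trans (n∣lcm[m,n] c (suc j)) (subst (_∣ lcm[1‥ j ]) c≡ c∣L)))

  #fresh-divisors≤ : ∀ {m a} j → .{{NonZero m}} → m ≤ 2 ^ a → #divisors (fresh j) m ≤ a
  #fresh-divisors≤ {m} {a} j m≤2^a with 2^#fresh-divisors≤ {m} j
  ... | c , _ , c∣m , _ , ≤c = ≮⇒≥ λ a<# →
    <⇒≱ (^-monoʳ-< 2 (s≤s (s≤s z≤n)) a<#) (≤-trans ≤c (≤-trans (∣⇒≤ c∣m) m≤2^a))

  -- Fresh numbers are prime powers.

  IsPrimePower : ℕ → Set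
  IsPrimePower q = ∃[ p ] ∃[ α ] (Prime p × q ≡ p ^ suc α)

  ∃prime∣ : ∀ n → .{{NonTrivial n}} → ∃[ p ] (Prime p × p ∣ n)
  ∃prime∣ n with factorise n {{nonTrivial⇒nonZero n}}
  ... | record { factors = [] ; isFactorisation = n≡1 } = ⊥-elim (nonTrivial⇒≢1 n≡1)
  ... | record { factors = p ∷ ps ; isFactorisation = n≡ ; factorsPrime = pr All.∷ _ } =
    p , pr , divides (product ps) (trans n≡ (*-comm p (product ps)))

  prime∤⇒coprime : ∀ {p c} → Prime p → ¬ p ∣ c → Coprime p c
  prime∤⇒coprime pr p∤c (d∣p , d∣c) with prime⇒irreducible pr d∣p
  ... | inj₁ d≡1  = d≡1
  ... | inj₂ refl = ⊥-elim (p∤c d∣c)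

  coprime-^ : ∀ {m n} α → Coprime m n → Coprime (m ^ α) n
  coprime-^ zero    _   (d∣1 , _) = ∣1⇒≡1 d∣1
  coprime-^ (suc α) cop (d∣ , d∣n) =
    coprime-^ α cop (coprime-divisor (λ (e∣d , e∣m) → cop (e∣m , ∣-trans e∣d d∣n)) d∣ , d∣n)

  coprime-*-∣ : ∀ {m n L} → Coprime m n → m ∣ L → n ∣ L → m * n ∣ L
  coprime-*-∣ {m} {n} cop (divides k refl) n∣L =
    subst (m * n ∣_) (*-comm m k)
      (*-monoʳ-∣ m (coprime-divisor (Coprime.sym cop) (subst (n ∣_) (*-comm k m) n∣L)))

  prime-part : ∀ {p} → Prime p → ∀ n → .{{NonZero n}} → ∃[ α ] ∃[ b ] (n ≡ p ^ α * b × ¬ p ∣ b)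
  prime-part {p} pr n = go n (<-wellFounded n)
    where
    instance
      _ = prime⇒nonZero pr
      _ = prime⇒nonTrivial pr
    go : ∀ n → Acc _<_ n → .{{NonZero n}} → ∃[ α ] ∃[ b ] (n ≡ p ^ α * b × ¬ p ∣ b)
    go n (acc rec) with p ∣? n
    ... | no  p∤n = 0 , n , sym (*-identityˡ n) , p∤n
    ... | yes p∣n with go (quotient p∣n) (rec (quotient-< p∣n)) {{quotient≢0 p∣n}}
    ...   | α , b , eq , p∤b = suc α , b ,
      trans (m∣n⇒n≡m*quotient p∣n) (trans (cong (p *_) eq) (sym (*-assoc p (p ^ α) b))) , p∤b

  -- Split off the full power of a prime p. If the cofactor b exceeds 1, both coprime factors are
  -- smaller than `suc i`, so each divides `lcm[1‥ i ]`, and then so does their product.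
  fresh⇒primePower : ∀ i → ¬ suc i ∣ lcm[1‥ i ] → IsPrimePower (suc i)
  fresh⇒primePower zero    1∤ = ⊥-elim (1∤ (1∣ _))
  fresh⇒primePower (suc i) n∤ with ∃prime∣ (2 + i)
  ... | p , pr , p∣n with prime-part pr (2 + i)
  ...   | zero , b , eq , p∤b = ⊥-elim (p∤b (subst (p ∣_) (trans eq (*-identityˡ b)) p∣n))
  ...   | suc α , 0 , eq , _ = ⊥-elim (1+n≢0 (trans eq (*-zeroʳ (p ^ suc α))))
  ...   | suc α , 1 , eq , _ = p , α , pr , trans eq (*-identityʳ (p ^ suc α))
  ...   | suc α , b@(suc (suc b′)) , eq , p∤b = ⊥-elim (n∤ (subst (_∣ lcm[1‥ suc i ]) (sym eq)
          (coprime-*-∣ (coprime-^ (suc α) (prime∤⇒coprime pr p∤b))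
            (≤⇒∣lcm[1‥] (>-nonZero⁻¹ q) (≤-pred (subst (q <_) (sym eq) (m<m*n q b (s≤s (s≤s z≤n))))))
            (≤⇒∣lcm[1‥] (s≤s z≤n) (≤-pred (subst (b <_) (trans (*-comm b q) (sym eq)) (m<m*n b q q>1)))))))
    where
    q = p ^ suc α
    instance
      _ = prime⇒nonZero pr
      _ = m^n≢0 p (suc α)
    q>1 : 1 < q
    q>1 = ≤-trans (nonTrivial⇒n>1 p {{prime⇒nonTrivial pr}}) (m≤m*n p (p ^ α) {{m^n≢0 p α}})

  fresh-primePowers : ∀ j → All.All IsPrimePower (fresh j)
  fresh-primePowers zero = All.[]
  fresh-primePowers (suc j) with suc j ∣? lcm[1‥ j ]
  ... | yes _    = fresh-primePowers j
  ... | no 1+j∤L = fresh⇒primePower j 1+j∤L All.∷ fresh-primePowers j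

  fresh-≤ : ∀ j → All.All (_≤ j) (fresh j)
  fresh-≤ zero = All.[]
  fresh-≤ (suc j) with suc j ∣? lcm[1‥ j ]
  ... | yes _ = All.map m≤n⇒m≤1+n (fresh-≤ j)
  ... | no  _ = ≤-refl All.∷ All.map m≤n⇒m≤1+n (fresh-≤ j)

  -- The indicator of divisibility by q as a binomial coefficient modulo p.

  ⟦∣⟧-yes : ∀ {q m} → q ∣ m → ⟦ q ∣ m ⟧ ≡ 1
  ⟦∣⟧-yes {q} {m} q∣m with q ∣? m
  ... | yes _  = refl
  ... | no q∤m = ⊥-elim (q∤m q∣m)

  ⟦∣⟧-no : ∀ {q m} → ¬ q ∣ m → ⟦ q ∣ m ⟧ ≡ 0
  ⟦∣⟧-no {q} {m} q∤m with q ∣? m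
  ... | yes q∣m = ⊥-elim (q∤m q∣m)
  ... | no _    = refl

  ⟦∣⟧-cong : ∀ {q m n} → (q ∣ m → q ∣ n) → (q ∣ n → q ∣ m) → ⟦ q ∣ m ⟧ ≡ ⟦ q ∣ n ⟧
  ⟦∣⟧-cong {q} {m} to from with q ∣? m
  ... | yes q∣m = sym (⟦∣⟧-yes (to q∣m))
  ... | no q∤m  = sym (⟦∣⟧-no (λ q∣n → q∤m (from q∣n)))

  module _ {p} (pr : Prime p) (α : ℕ) {q′} (q≡ : suc q′ ≡ p ^ suc α) where

    -- If p does not divide C(q, k + 1), then q is coprime to it. By absorption q divides (k + 1)
    -- C(q, k + 1), hence k + 1, although 0 < k + 1 < q.
    p∣qCk : ∀ k → k < q′ → p ∣ suc q′ C suc k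
    p∣qCk k k<q′ with p ∣? (suc q′ C suc k)
    ... | yes p∣ = p∣
    ... | no  p∤ = ⊥-elim (>⇒∤ (s≤s k<q′) (coprime-divisor
        (subst (λ q → Coprime q (suc q′ C suc k)) (sym q≡) (coprime-^ (suc α) (prime∤⇒coprime pr p∤)))
        (divides (q′ C k) (trans (*-comm (suc q′ C suc k) (suc k))
          (trans ([1+k]*[1+n]C[1+k]≡[1+n]*nCk q′ k) (*-comm (suc q′) (q′ C k)))))))

    -- (1 + x)^q ≡ 1 + x^q modulo p, read off coefficientwise.
    C-periodic : ∀ s k → k ≤ q′ → ∃[ u ] ((s + suc q′) C k ≡ s C k + u * p)
    C-periodic s zero _ = 0 , trans (nC0≡1 (s + suc q′)) (sym (trans (+-identityʳ _) (nC0≡1 s)))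
    C-periodic zero (suc k) k<q′ with p∣qCk k k<q′
    ... | divides u eq = u , trans eq (cong (_+ u * p) (sym (k>n⇒nCk≡0 {0} {suc k} (s≤s z≤n))))
    C-periodic (suc s) (suc k) k<q′ with C-periodic s k (<⇒≤ k<q′) | C-periodic s (suc k) k<q′
    ... | u , eq | v , eq′ = u + v , (begin
      suc (s + suc q′) C suc k                        ≡⟨ nCk+nC[k+1]≡[n+1]C[k+1] (s + suc q′) k ⟨
      (s + suc q′) C k + (s + suc q′) C suc k         ≡⟨ cong₂ _+_ eq eq′ ⟩
      (s C k + u * p) + (s C suc k + v * p)           ≡⟨ regroup (s C k) (s C suc k) u v p ⟩
      (s C k + s C suc k) + (u + v) * p               ≡⟨ cong (_+ (u + v) * p) (nCk+nC[k+1]≡[n+1]C[k+1] s k) ⟩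
      suc s C suc k + (u + v) * p                     ∎)
      where
      open ≡-Reasoning
      regroup : ∀ a b u v p → (a + u * p) + (b + v * p) ≡ (a + b) + (u + v) * p
      regroup = solve-∀

    C-periodic-* : ∀ r t → ∃[ u ] ((r + t * suc q′) C q′ ≡ r C q′ + u * p)
    C-periodic-* r zero = 0 , trans (cong (_C q′) (+-identityʳ r)) (sym (+-identityʳ (r C q′)))
    C-periodic-* r (suc t) with C-periodic-* r t | C-periodic (r + t * suc q′) q′ ≤-refl
    ... | u , eq | v , eq′ = u + v , (begin
      (r + suc t * suc q′) C q′             ≡⟨ cong (_C q′) (regroup r t q′) ⟩
      ((r + t * suc q′) + suc q′) C q′      ≡⟨ eq′ ⟩
      (r + t * suc q′) C q′ + v * p         ≡⟨ cong (_+ v * p) eq ⟩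
      (r C q′ + u * p) + v * p              ≡⟨ regroup′ (r C q′) u v p ⟩
      r C q′ + (u + v) * p                  ∎)
      where
      open ≡-Reasoning
      regroup : ∀ r t q′ → r + suc t * suc q′ ≡ (r + t * suc q′) + suc q′
      regroup = solve-∀
      regroup′ : ∀ c u v p → (c + u * p) + v * p ≡ c + (u + v) * p
      regroup′ = solve-∀

    -- By periodicity s may be replaced by its remainder r ≤ q - 1, and C(r, q - 1) is 1 for r = q -
    -- 1, that is for q ∣ s + 1, and 0 otherwise.
    sC[q-1]≡⟦q∣1+s⟧ : ∀ s → ∃[ u ] (s C q′ ≡ ⟦ suc q′ ∣ suc s ⟧ + u * p)
    sC[q-1]≡⟦q∣1+s⟧ s with C-periodic-* (s % suc q′) (s / suc q′)
    ... | u , eq = u , trans (cong (_C q′) s≡) (trans eq (cong (_+ u * p) residue))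
      where
      s≡ : s ≡ s % suc q′ + (s / suc q′) * suc q′
      s≡ = m≡m%n+[m/n]*n s (suc q′)
      residue : (s % suc q′) C q′ ≡ ⟦ suc q′ ∣ suc s ⟧
      residue with m≤n⇒m<n∨m≡n (≤-pred (m%n<n s (suc q′)))
      ... | inj₁ r<q′ = trans (k>n⇒nCk≡0 r<q′) (sym (⟦∣⟧-no λ q∣ → >⇒∤ (s≤s r<q′)
              (∣m+n∣m⇒∣n (subst (suc q′ ∣_) (trans (cong suc s≡) (+-comm (suc (s % suc q′)) _)) q∣) (n∣m*n (s / suc q′)))))
      ... | inj₂ r≡q′ = trans (cong (_C q′) r≡q′) (trans (nCn≡1 q′) (sym (⟦∣⟧-yes
              (divides (suc (s / suc q′)) (cong suc (trans s≡ (cong (_+ (s / suc q′) * suc q′) r≡q′)))))))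

    -- At z = y - w the top z - 1 of the binomial coefficient may be negative. Adding (w + 1) q to z
    -- keeps divisibility by q and turns the top into the natural number y + (w + 1)(q - 1).
    shift-∣ : ∀ y w → ⟦ suc q′ ∣ suc (y + suc w * q′) ⟧ ≡ ⟦ suc q′ ∣ ∣ y - w ∣ ⟧
    shift-∣ y w with ≤-total w y
    ... | inj₁ w≤y rewrite m≤n⇒∣n-m∣≡n∸m w≤y = ⟦∣⟧-cong
        (λ q∣ → ∣m+n∣m⇒∣n (subst (suc q′ ∣_) eq q∣) (n∣m*n (suc w)))
        (λ q∣ → subst (suc q′ ∣_) (sym eq) (∣m∣n⇒∣m+n (n∣m*n (suc w)) q∣))
      where
      regroup : ∀ w d q → suc ((w + d) + suc w * q) ≡ suc w * suc q + d
      regroup = solve-∀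
      eq : suc (y + suc w * q′) ≡ suc w * suc q′ + (y ∸ w)
      eq = trans (cong (λ y → suc (y + suc w * q′)) (sym (m+[n∸m]≡n w≤y))) (regroup w (y ∸ w) q′)
    ... | inj₂ y≤w rewrite m≤n⇒∣m-n∣≡n∸m y≤w = ⟦∣⟧-cong
        (λ q∣ → ∣m+n∣m⇒∣n (subst (suc q′ ∣_) eq (n∣m*n (suc w))) q∣)
        (λ q∣ → ∣m+n∣m⇒∣n (subst (suc q′ ∣_) (trans eq (+-comm (suc (y + suc w * q′)) (w ∸ y))) (n∣m*n (suc w))) q∣)
      where
      regroup : ∀ y w d q → suc w * q + suc (y + d) ≡ suc (y + suc w * q) + d
      regroup = solve-∀
      eq : suc w * suc q′ ≡ suc (y + suc w * q′) + (w ∸ y)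
      eq = trans (*-suc (suc w) q′) (trans (+-comm (suc w) (suc w * q′))
        (trans (cong (λ z → suc w * q′ + suc z) (sym (m+[n∸m]≡n y≤w))) (regroup y w (w ∸ y) q′)))

  -- Degree via finite differences.

  δ : (ℕ → ℤ) → ℕ → ℤ
  δ f y = f (suc y) ℤ.- f y

  -- The difference of order d + 1 vanishes. Measuring degree by differences keeps everything
  -- integral, also for binomial coefficients, whose ordinary coefficients are fractions; Newton's
  -- formula recovers a multilinear polynomial later.
  Deg≤ : ℕ → (ℕ → ℤ) → Set
  Deg≤ zero    f = ∀ y → δ f y ≡ 0ℤ
  Deg≤ (suc d) f = Deg≤ d (δ f)

  Deg≤-cong : ∀ d {f g} → (∀ y → f y ≡ g y) → Deg≤ d f → Deg≤ d g
  Deg≤-cong zero    f≗g df y = trans (sym (cong₂ ℤ._-_ (f≗g (suc y)) (f≗g y))) (df y)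
  Deg≤-cong (suc d) f≗g df   = Deg≤-cong d (λ y → cong₂ ℤ._-_ (f≗g (suc y)) (f≗g y)) df

  Deg≤-const : ∀ d c → Deg≤ d (λ _ → c)
  Deg≤-const zero    c y = ℤ.+-inverseʳ c
  Deg≤-const (suc d) c   = Deg≤-cong d (λ _ → sym (ℤ.+-inverseʳ c)) (Deg≤-const d 0ℤ)

  Deg≤-suc : ∀ d {f} → Deg≤ d f → Deg≤ (suc d) f
  Deg≤-suc zero    df y = cong₂ ℤ._-_ (df (suc y)) (df y)
  Deg≤-suc (suc d) df   = Deg≤-suc d df

  Deg≤-mono : ∀ {d d′ f} → d ≤ d′ → Deg≤ d f → Deg≤ d′ f
  Deg≤-mono {zero} {zero}   _ df = df
  Deg≤-mono {zero} {suc d′} {f} _ df = Deg≤-suc d′ {f} (Deg≤-mono {zero} {d′} {f} z≤n df)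
  Deg≤-mono {suc d} (s≤s d≤d′) df = Deg≤-mono d≤d′ df

  δ-+ : ∀ f g y → δ f y ℤ.+ δ g y ≡ δ (λ y → f y ℤ.+ g y) y
  δ-+ f g y = regroup (f (suc y)) (f y) (g (suc y)) (g y)
    where
    regroup : ∀ a b c d → (a ℤ.- b) ℤ.+ (c ℤ.- d) ≡ (a ℤ.+ c) ℤ.- (b ℤ.+ d)
    regroup = ℤ-Solver.solve-∀

  Deg≤-+ : ∀ d {f g} → Deg≤ d f → Deg≤ d g → Deg≤ d (λ y → f y ℤ.+ g y)
  Deg≤-+ zero    {f} {g} df dg y = trans (sym (δ-+ f g y)) (cong₂ ℤ._+_ (df y) (dg y))
  Deg≤-+ (suc d) {f} {g} df dg   = Deg≤-cong d (δ-+ f g) (Deg≤-+ d df dg)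

  Deg≤-shift : ∀ d {f} → Deg≤ d f → Deg≤ d (λ y → f (suc y))
  Deg≤-shift zero    df y = df (suc y)
  Deg≤-shift (suc d) df   = Deg≤-shift d df

  δ-* : ∀ f g y → δ f y ℤ.* g (suc y) ℤ.+ f y ℤ.* δ g y ≡ δ (λ y → f y ℤ.* g y) y
  δ-* f g y = leibniz (f (suc y)) (f y) (g (suc y)) (g y)
    where
    leibniz : ∀ a b c d → (a ℤ.- b) ℤ.* c ℤ.+ b ℤ.* (c ℤ.- d) ≡ a ℤ.* c ℤ.- b ℤ.* d
    leibniz = ℤ-Solver.solve-∀

  -- The Leibniz rule writes δ(fg) as δf times a shift of g, plus f times δg, and the degrees of
  -- both products add up to one less. If a factor is constant, its difference is zero and one
  -- product drops out.
  Deg≤-* : ∀ a b {f g} → Deg≤ a f → Deg≤ b g → Deg≤ (a + b) (λ y → f y ℤ.* g y)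
  Deg≤-* zero zero {f} {g} df dg y = trans (sym (δ-* f g y))
    (trans (cong₂ (λ u v → u ℤ.* g (suc y) ℤ.+ f y ℤ.* v) (df y) (dg y)) (zero-sum (g (suc y)) (f y)))
    where
    zero-sum : ∀ u v → 0ℤ ℤ.* u ℤ.+ v ℤ.* 0ℤ ≡ 0ℤ
    zero-sum = ℤ-Solver.solve-∀
  Deg≤-* zero (suc b) {f} {g} df dg = Deg≤-cong b
    (λ y → trans (drop (f y ℤ.* δ g y) (g (suc y))) (trans (cong (λ u → u ℤ.* g (suc y) ℤ.+ f y ℤ.* δ g y) (sym (df y))) (δ-* f g y)))
    (Deg≤-* zero b {f} df dg)
    where
    drop : ∀ u v → u ≡ 0ℤ ℤ.* v ℤ.+ u
    drop = ℤ-Solver.solve-∀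
  Deg≤-* (suc a) zero {f} {g} df dg = Deg≤-cong (a + 0)
    (λ y → trans (drop (δ f y ℤ.* g (suc y)) (f y)) (trans (cong (λ u → δ f y ℤ.* g (suc y) ℤ.+ f y ℤ.* u) (sym (dg y))) (δ-* f g y)))
    (Deg≤-* a zero df (Deg≤-shift zero {g} dg))
    where
    drop : ∀ u v → u ≡ u ℤ.+ v ℤ.* 0ℤ
    drop = ℤ-Solver.solve-∀
  Deg≤-* (suc a) (suc b) {f} {g} df dg = Deg≤-cong (a + suc b) (δ-* f g)
    (Deg≤-+ (a + suc b) (Deg≤-* a (suc b) df (Deg≤-shift b dg))
      (subst (λ d → Deg≤ d (λ y → f y ℤ.* δ g y)) (sym (+-suc a b)) (Deg≤-* (suc a) b {f} df dg)))

  Deg≤-^ : ∀ d k {f} → Deg≤ d f → Deg≤ (k * d) (λ y → f y ℤ.^ k)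
  Deg≤-^ d zero    df = Deg≤-const 0 1ℤ
  Deg≤-^ d (suc k) {f} df = Deg≤-* d (k * d) {f} df (Deg≤-^ d k {f} df)

  -- By Pascal's rule, differencing lowers the bottom index by one.
  Deg≤-C : ∀ k c → Deg≤ k (λ y → + ((y + c) C k))
  Deg≤-C zero c y = trans (cong₂ (λ u v → + u ℤ.- + v) (nC0≡1 (suc y + c)) (nC0≡1 (y + c))) refl
  Deg≤-C (suc k) c = Deg≤-cong k (λ y → sym (pascal (y + c))) (Deg≤-C k c)
    where
    cancel : ∀ u v → (u ℤ.+ v) ℤ.- v ≡ u
    cancel = ℤ-Solver.solve-∀
    pascal : ∀ s → + (suc s C suc k) ℤ.- + (s C suc k) ≡ + (s C k)
    pascal s = trans (cong (λ u → + u ℤ.- + (s C suc k)) (sym (nCk+nC[k+1]≡[n+1]C[k+1] s k)))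
      (trans (cong (λ t → t ℤ.- + (s C suc k)) (ℤ.pos-+ (s C k) (s C suc k))) (cancel (+ (s C k)) (+ (s C suc k))))

  δ^ : ℕ → (ℕ → ℤ) → ℕ → ℤ
  δ^ zero    f = f
  δ^ (suc j) f = δ^ j (δ f)

  δ^-zero : ∀ j {f} → (∀ y → f y ≡ 0ℤ) → ∀ y → δ^ j f y ≡ 0ℤ
  δ^-zero zero    f≗0 = f≗0
  δ^-zero (suc j) f≗0 = δ^-zero j (λ y → cong₂ ℤ._-_ (f≗0 (suc y)) (f≗0 y))

  δ^-vanishes : ∀ {d j f} → Deg≤ d f → d < j → ∀ y → δ^ j f y ≡ 0ℤ
  δ^-vanishes {zero}  {suc j} df _         = δ^-zero j df
  δ^-vanishes {suc d} {suc j} df (s≤s d<j) = δ^-vanishes {d} df d<j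

  -- Modulus amplification.

  ^-distribʳ-* : ∀ x y n → (x ℤ.* y) ℤ.^ n ≡ x ℤ.^ n ℤ.* y ℤ.^ n
  ^-distribʳ-* x y zero    = refl
  ^-distribʳ-* x y (suc n) = trans (cong ((x ℤ.* y) ℤ.*_) (^-distribʳ-* x y n)) (regroup x y (x ℤ.^ n) (y ℤ.^ n))
    where
    regroup : ∀ a b c d → (a ℤ.* b) ℤ.* (c ℤ.* d) ≡ (a ℤ.* c) ℤ.* (b ℤ.* d)
    regroup = ℤ-Solver.solve-∀

  pos-^ : ∀ m n → (+ m) ℤ.^ n ≡ + (m ^ n)
  pos-^ m zero    = refl
  pos-^ m (suc n) = trans (cong (+ m ℤ.*_) (pos-^ m n)) (sym (ℤ.pos-* m (m ^ n)))

  [1+cx]^n : ∀ c x n → ∃[ z ] ((1ℤ ℤ.+ c ℤ.* x) ℤ.^ n ≡ 1ℤ ℤ.+ c ℤ.* z)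
  [1+cx]^n c x zero = 0ℤ , sym (cong (λ t → 1ℤ ℤ.+ t) (ℤ.*-zeroʳ c))
  [1+cx]^n c x (suc n) with [1+cx]^n c x n
  ... | z , eq = x ℤ.+ z ℤ.+ c ℤ.* x ℤ.* z , trans (cong ((1ℤ ℤ.+ c ℤ.* x) ℤ.*_) eq) (expand c x z)
    where
    expand : ∀ c x z → (1ℤ ℤ.+ c ℤ.* x) ℤ.* (1ℤ ℤ.+ c ℤ.* z) ≡ 1ℤ ℤ.+ c ℤ.* (x ℤ.+ z ℤ.+ c ℤ.* x ℤ.* z)
    expand = ℤ-Solver.solve-∀

  -- Modulus amplification: a value ≡ b (mod c) with b ∈ {0, 1} becomes ≡ b (mod cᵏ).
  amplify : ℕ → ℤ → ℤ
  amplify k x = 1ℤ ℤ.- (1ℤ ℤ.- x ℤ.^ k) ℤ.^ k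

  -- The inner power does the work: (cu)^k is 0 modulo c^k, so 1 - (cu)^k is 1 modulo c^k, and the
  -- outer power preserves this.
  amplify-0 : ∀ k c u → ∃[ v ] (amplify k (c ℤ.* u) ≡ c ℤ.^ k ℤ.* v)
  amplify-0 k c u with [1+cx]^n (c ℤ.^ k) (ℤ.- u ℤ.^ k) k
  ... | z , eq = ℤ.- z , trans (cong (λ t → 1ℤ ℤ.- t)
          (trans (cong (ℤ._^ k) (trans (cong (λ t → 1ℤ ℤ.- t) (^-distribʳ-* c u k)) (sign (c ℤ.^ k) (u ℤ.^ k)))) eq))
          (collect (c ℤ.^ k) z)
    where
    sign : ∀ a b → 1ℤ ℤ.- a ℤ.* b ≡ 1ℤ ℤ.+ a ℤ.* (ℤ.- b)
    sign = ℤ-Solver.solve-∀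
    collect : ∀ a z → 1ℤ ℤ.- (1ℤ ℤ.+ a ℤ.* z) ≡ a ℤ.* (ℤ.- z)
    collect = ℤ-Solver.solve-∀

  -- The outer power does the work: x ≡ 1 gives x^k ≡ 1 modulo c, so 1 - x^k is a multiple of c and
  -- its k-th power a multiple of c^k.
  amplify-1 : ∀ k c u → ∃[ v ] (amplify k (1ℤ ℤ.+ c ℤ.* u) ≡ 1ℤ ℤ.+ c ℤ.^ k ℤ.* v)
  amplify-1 k c u with [1+cx]^n c u k
  ... | z , eq = ℤ.- (ℤ.- z) ℤ.^ k , trans (cong (λ t → 1ℤ ℤ.- t)
          (trans (cong (ℤ._^ k) (trans (cong (λ t → 1ℤ ℤ.- t) eq) (cancel c z))) (^-distribʳ-* c (ℤ.- z) k)))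
          (sign (c ℤ.^ k) ((ℤ.- z) ℤ.^ k))
    where
    cancel : ∀ c z → 1ℤ ℤ.- (1ℤ ℤ.+ c ℤ.* z) ≡ c ℤ.* (ℤ.- z)
    cancel = ℤ-Solver.solve-∀
    sign : ∀ a b → 1ℤ ℤ.- a ℤ.* b ≡ 1ℤ ℤ.+ a ℤ.* (ℤ.- b)
    sign = ℤ-Solver.solve-∀

  amplify-bit : ∀ {b} k p u → b ≡ 0 ⊎ b ≡ 1 →
    ∃[ v ] (amplify k (+ b ℤ.+ + p ℤ.* + u) ≡ + b ℤ.+ + (p ^ k) ℤ.* v)
  amplify-bit k p u (inj₁ refl) with amplify-0 k (+ p) (+ u)
  ... | v , eq = v , trans (cong (amplify k) (ℤ.+-identityˡ (+ p ℤ.* + u)))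
      (trans eq (trans (cong (ℤ._* v) (pos-^ p k)) (sym (ℤ.+-identityˡ (+ (p ^ k) ℤ.* v)))))
  amplify-bit k p u (inj₂ refl) with amplify-1 k (+ p) (+ u)
  ... | v , eq = v , trans eq (cong (λ t → 1ℤ ℤ.+ t ℤ.* v) (pos-^ p k))

  ⟦∣⟧-bit : ∀ q m → ⟦ q ∣ m ⟧ ≡ 0 ⊎ ⟦ q ∣ m ⟧ ≡ 1
  ⟦∣⟧-bit q m with q ∣? m
  ... | yes _ = inj₂ refl
  ... | no _  = inj₁ refl

  Deg≤-amplify : ∀ d k {f} → Deg≤ d f → Deg≤ (k * (k * d)) (λ y → amplify k (f y))
  Deg≤-amplify d k {f} df = one-minus (k * (k * d)) {λ y → (1ℤ ℤ.- f y ℤ.^ k) ℤ.^ k}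
    (Deg≤-^ (k * d) k {λ y → 1ℤ ℤ.- f y ℤ.^ k} (one-minus (k * d) {λ y → f y ℤ.^ k} (Deg≤-^ d k {f} df)))
    where
    rewrite-neg : ∀ x → 1ℤ ℤ.+ ℤ.-1ℤ ℤ.* x ≡ 1ℤ ℤ.- x
    rewrite-neg = ℤ-Solver.solve-∀
    one-minus : ∀ d {g} → Deg≤ d g → Deg≤ d (λ y → 1ℤ ℤ.- g y)
    one-minus d {g} dg = Deg≤-cong d (λ y → rewrite-neg (g y))
      (Deg≤-+ d {λ _ → 1ℤ} {λ y → ℤ.-1ℤ ℤ.* g y} (Deg≤-const d 1ℤ) (Deg≤-* 0 d {λ _ → ℤ.-1ℤ} {g} (Deg≤-const 0 ℤ.-1ℤ) dg))

  primePower-indicator : ∀ {q} → IsPrimePower q → ∀ w k →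
    ∃[ B ] ∃[ G ] (2 ^ k ≤ B × Deg≤ (k * (k * pred q)) G ×
      (∀ y → ∃[ v ] (G y ≡ + ⟦ q ∣ ∣ y - w ∣ ⟧ ℤ.+ + B ℤ.* v)))
  primePower-indicator {q} (p , α , pr , q≡) w k with q
  ... | zero = ⊥-elim (≢-nonZero⁻¹ (p ^ suc α) {{m^n≢0 p (suc α) {{prime⇒nonZero pr}}}} (sym q≡))
  ... | suc q′ = p ^ k , (λ y → amplify k (+ ((y + suc w * q′) C q′))) ,
    ^-monoˡ-≤ k (nonTrivial⇒n>1 p {{prime⇒nonTrivial pr}}) ,
    Deg≤-amplify q′ k {λ y → + ((y + suc w * q′) C q′)} (Deg≤-C q′ (suc w * q′)) , congruence
    where
    value : ∀ y → ∃[ u ] (+ ((y + suc w * q′) C q′) ≡ + ⟦ suc q′ ∣ ∣ y - w ∣ ⟧ ℤ.+ + p ℤ.* + u)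
    value y with sC[q-1]≡⟦q∣1+s⟧ pr α q≡ (y + suc w * q′)
    ... | u , eq = u , trans (cong +_ (trans eq (cong₂ _+_ (shift-∣ pr α q≡ y w) (*-comm u p))))
      (trans (ℤ.pos-+ ⟦ suc q′ ∣ ∣ y - w ∣ ⟧ (p * u)) (cong (λ t → + ⟦ suc q′ ∣ ∣ y - w ∣ ⟧ ℤ.+ t) (ℤ.pos-* p u)))
    congruence : ∀ y → ∃[ v ] (amplify k (+ ((y + suc w * q′) C q′)) ≡ + ⟦ suc q′ ∣ ∣ y - w ∣ ⟧ ℤ.+ + (p ^ k) ℤ.* v)
    congruence y with value y
    ... | u , eq with amplify-bit k p u (⟦∣⟧-bit (suc q′) ∣ y - w ∣)
    ...   | v , eq′ = v , trans (cong (amplify k) eq) eq′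

  -- The average of the indicators, in integer arithmetic.

  -- H(y)/B agrees modulo 1 with r(y)/B, which in turn is #{q ∈ qs : q ∣ y − w}/2T
  -- up to 2^(-k) per counted q.
  record Averaging (w k T D : ℕ) (qs : List ℕ) : Set where
    field
      B     : ℕ
      H     : ℕ → ℤ
      r     : ℕ → ℕ
      B≢0   : NonZero B
      deg   : Deg≤ (k * (k * D)) H
      H≡r   : ∀ y → ∃[ j ] (H y ≡ + r y ℤ.+ + B ℤ.* j)
      upper : ∀ y → 2 * T * r y ≤ B * #divisors qs ∣ y - w ∣
      lower : ∀ y → B * #divisors qs ∣ y - w ∣ * 2 ^ k ≤ 2 * T * 2 ^ k * r y + 2 * T * (B * #divisors qs ∣ y - w ∣)

  -- A new q adds M·G/P to H/B, over the common denominator BP, where M = ⌊P/2T⌋. As G is the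
  -- indicator modulo P, this is M/P times the indicator modulo 1, and M/P falls short of 1/2T by at
  -- most 1/P ≤ 2^(-k).
  averaging : ∀ w k T D qs → .{{NonZero T}} → All.All IsPrimePower qs → All.All (_≤ suc D) qs → Averaging w k T D qs
  averaging w k T D [] _ _ = record
    { B     = 1
    ; H     = λ _ → 0ℤ
    ; r     = λ _ → 0
    ; B≢0   = _
    ; deg   = Deg≤-const (k * (k * D)) 0ℤ
    ; H≡r   = λ _ → 0ℤ , refl
    ; upper = λ _ → ≤-reflexive (*-zeroʳ (2 * T))
    ; lower = λ _ → z≤n
    }
  averaging w k T D (q ∷ qs) (pp All.∷ pps) (q≤1+D All.∷ qs≤) with averaging w k T D qs pps qs≤ | primePower-indicator pp w k
  ... | rec | P , G , 2^k≤P , degG , G≡ = record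
    { B     = B * P
    ; H     = λ y → + P ℤ.* H y ℤ.+ + (M * B) ℤ.* G y
    ; r     = λ y → P * r y + M * B * bit y
    ; B≢0   = m*n≢0 B P {{B≢0}} {{>-nonZero (≤-trans (m^n>0 2 k) 2^k≤P)}}
    ; deg   = Deg≤-+ (k * (k * D)) {λ y → + P ℤ.* H y} {λ y → + (M * B) ℤ.* G y}
                (Deg≤-* 0 (k * (k * D)) {λ _ → + P} {H} (Deg≤-const 0 (+ P)) deg)
                (Deg≤-* 0 (k * (k * D)) {λ _ → + (M * B)} {G} (Deg≤-const 0 (+ (M * B)))
                  (Deg≤-mono {f = G} (*-monoʳ-≤ k (*-monoʳ-≤ k (pred-mono-≤ q≤1+D))) degG))
    ; H≡r   = congruence
    ; upper = λ y → upper′ (r y) (bit y) (count y) (upper y)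
    ; lower = λ y → lower′ (r y) (bit y) (count y) (lower y)
    }
    where
    open Averaging rec
    open ≤-Reasoning
    instance
      _ = m*n≢0 2 T
    M = P / (2 * T)
    Z = 2 ^ k
    bit : ℕ → ℕ
    bit y = ⟦ q ∣ ∣ y - w ∣ ⟧
    count : ℕ → ℕ
    count y = #divisors qs ∣ y - w ∣

    M≤ : 2 * T * M ≤ P
    M≤ = ≤-trans (≤-reflexive (*-comm (2 * T) M)) (m/n*n≤m P (2 * T))

    M≥ : P ≤ 2 * T * M + 2 * T
    M≥ = begin
      P                             ≡⟨ m≡m%n+[m/n]*n P (2 * T) ⟩
      P % (2 * T) + M * (2 * T)     ≤⟨ +-monoˡ-≤ (M * (2 * T)) (<⇒≤ (m%n<n P (2 * T))) ⟩
      2 * T + M * (2 * T)           ≡⟨ +-comm (2 * T) (M * (2 * T)) ⟩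
      M * (2 * T) + 2 * T           ≡⟨ cong (λ t → t + 2 * T) (*-comm M (2 * T)) ⟩
      2 * T * M + 2 * T             ∎

    congruence : ∀ y → ∃[ j ] (+ P ℤ.* H y ℤ.+ + (M * B) ℤ.* G y ≡ + (P * r y + M * B * bit y) ℤ.+ + (B * P) ℤ.* j)
    congruence y with H≡r y | G≡ y
    ... | j , Hy≡ | v , Gy≡ = j ℤ.+ + M ℤ.* v , trans (cong₂ (λ h g → + P ℤ.* h ℤ.+ + (M * B) ℤ.* g) Hy≡ Gy≡)
      (trans (cong (λ mb → + P ℤ.* (+ r y ℤ.+ + B ℤ.* j) ℤ.+ mb ℤ.* (+ bit y ℤ.+ + P ℤ.* v)) (ℤ.pos-* M B))
      (trans (collect (+ P) (+ r y) (+ B) j (+ M) (+ bit y) v) (sym casts)))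
      where
      collect : ∀ P r B j M b v → P ℤ.* (r ℤ.+ B ℤ.* j) ℤ.+ (M ℤ.* B) ℤ.* (b ℤ.+ P ℤ.* v)
                                ≡ (P ℤ.* r ℤ.+ M ℤ.* B ℤ.* b) ℤ.+ (B ℤ.* P) ℤ.* (j ℤ.+ M ℤ.* v)
      collect = ℤ-Solver.solve-∀
      casts : + (P * r y + M * B * bit y) ℤ.+ + (B * P) ℤ.* (j ℤ.+ + M ℤ.* v)
            ≡ (+ P ℤ.* + r y ℤ.+ + M ℤ.* + B ℤ.* + bit y) ℤ.+ (+ B ℤ.* + P) ℤ.* (j ℤ.+ + M ℤ.* v)
      casts = cong₂ (λ a b → a ℤ.+ b ℤ.* (j ℤ.+ + M ℤ.* v))
        (trans (ℤ.pos-+ (P * r y) (M * B * bit y)) (cong₂ ℤ._+_ (ℤ.pos-* P (r y))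
          (trans (ℤ.pos-* (M * B) (bit y)) (cong (ℤ._* + bit y) (ℤ.pos-* M B)))))
        (ℤ.pos-* B P)

    upper′ : ∀ r b c → 2 * T * r ≤ B * c → 2 * T * (P * r + M * B * b) ≤ B * P * (b + c)
    upper′ r b c rec-upper = begin
      2 * T * (P * r + M * B * b)           ≡⟨ regroup T P r M B b ⟩
      P * (2 * T * r) + 2 * T * M * (B * b) ≤⟨ +-mono-≤ (*-monoʳ-≤ P rec-upper) (*-monoˡ-≤ (B * b) M≤) ⟩
      P * (B * c) + P * (B * b)             ≡⟨ regroup′ P B b c ⟩
      B * P * (b + c)                       ∎
      where
      regroup : ∀ T P r M B b → 2 * T * (P * r + M * B * b) ≡ P * (2 * T * r) + 2 * T * M * (B * b)
      regroup = solve-∀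
      regroup′ : ∀ P B b c → P * (B * c) + P * (B * b) ≡ B * P * (b + c)
      regroup′ = solve-∀

    lower′ : ∀ r b c → B * c * Z ≤ 2 * T * Z * r + 2 * T * (B * c) →
             B * P * (b + c) * Z ≤ 2 * T * Z * (P * r + M * B * b) + 2 * T * (B * P * (b + c))
    lower′ r b c rec-lower = begin
      B * P * (b + c) * Z
        ≡⟨ regroup B P b c Z ⟩
      P * (B * c * Z) + B * b * Z * P
        ≤⟨ +-mono-≤ (*-monoʳ-≤ P rec-lower) (*-monoʳ-≤ (B * b * Z) M≥) ⟩
      P * (2 * T * Z * r + 2 * T * (B * c)) + B * b * Z * (2 * T * M + 2 * T)
        ≡⟨ regroup′ B P b c Z T M r ⟩
      2 * T * Z * (P * r + M * B * b) + 2 * T * (B * P * c) + 2 * T * (B * b) * Z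
        ≤⟨ +-monoʳ-≤ (2 * T * Z * (P * r + M * B * b) + 2 * T * (B * P * c)) (*-monoʳ-≤ (2 * T * (B * b)) 2^k≤P) ⟩
      2 * T * Z * (P * r + M * B * b) + 2 * T * (B * P * c) + 2 * T * (B * b) * P
        ≡⟨ regroup″ (2 * T * Z * (P * r + M * B * b)) T B P b c ⟩
      2 * T * Z * (P * r + M * B * b) + 2 * T * (B * P * (b + c)) ∎
      where
      regroup : ∀ B P b c Z → B * P * (b + c) * Z ≡ P * (B * c * Z) + B * b * Z * P
      regroup = solve-∀
      regroup′ : ∀ B P b c Z T M r → P * (2 * T * Z * r + 2 * T * (B * c)) + B * b * Z * (2 * T * M + 2 * T)
        ≡ 2 * T * Z * (P * r + M * B * b) + 2 * T * (B * P * c) + 2 * T * (B * b) * Z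
      regroup′ = solve-∀
      regroup″ : ∀ X T B P b c → X + 2 * T * (B * P * c) + 2 * T * (B * b) * P ≡ X + 2 * T * (B * P * (b + c))
      regroup″ = solve-∀

  -- Choice of D and k, and the resulting integer approximation.

  #divisors-0 : ∀ qs → #divisors qs 0 ≡ length qs
  #divisors-0 []       = refl
  #divisors-0 (q ∷ qs) = cong₂ _+_ (⟦∣⟧-yes (q ∣0)) (#divisors-0 qs)

  n<2^n : ∀ n → n < 2 ^ n
  n<2^n zero    = s≤s z≤n
  n<2^n (suc n) = begin-strict
    suc n             ≤⟨ n<2^n n ⟩
    2 ^ n             <⟨ m<n+m (2 ^ n) (m^n>0 2 n) ⟩
    2 ^ n + 2 ^ n     ≡⟨ cong (λ t → 2 ^ n + t) (+-identityʳ (2 ^ n)) ⟨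
    2 ^ suc n         ∎
    where open ≤-Reasoning

  -- Here e stands for ⌈1/ε⌉ and a for a bound on the logarithms of n and e. With 4a as a bound on
  -- log(D + 1) there are T ≥ ae fresh numbers, of which at most a divide a nonzero y - w: a
  -- fraction of at most 1/e.
  D : ℕ → ℕ → ℕ
  D a e = 4 * a * (a * e)

  -- The amplified degree k²D for k = 5a.
  degree : ℕ → ℕ → ℕ
  degree a e = 5 * a * (5 * a * D a e)

  -- The origin of the exponent 20: the constant 200 is at most 2^(8b), and each of the four factors
  -- 3 + m is at most 2^(3b). The factor 2 on the left is there to absorb eε ≤ 2.
  2*degree≤ : ∀ {m b e} → 1 ≤ b → m < 2 ^ suc b → 2 * degree (3 + m) e ≤ 2 ^ (20 * b) * e
  2*degree≤ {m} {b} {e} 1≤b m< = begin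
    2 * degree a e                                ≡⟨ expand a e ⟩
    200 * (a * a * (a * a)) * e                   ≤⟨ *-monoˡ-≤ e (*-mono-≤ 200≤ (*-mono-≤ (*-mono-≤ a≤ a≤) (*-mono-≤ a≤ a≤))) ⟩
    2 ^ (8 * b) * (2 ^ (3 * b) * 2 ^ (3 * b) * (2 ^ (3 * b) * 2 ^ (3 * b))) * e
                                                  ≡⟨ cong (_* e) powers ⟩
    2 ^ (20 * b) * e                              ∎
    where
    open ≤-Reasoning
    a = 3 + m
    expand : ∀ a e → 2 * (5 * a * (5 * a * (4 * a * (a * e)))) ≡ 200 * (a * a * (a * a)) * e
    expand = solve-∀
    200≤ : 200 ≤ 2 ^ (8 * b)
    200≤ = ≤-trans (m≤m+n 200 56) (^-monoʳ-≤ 2 (*-monoʳ-≤ 8 1≤b))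
    a≤ : a ≤ 2 ^ (3 * b)
    a≤ = begin
      2 + suc m                   ≤⟨ +-mono-≤ (^-monoʳ-≤ 2 (s≤s (z≤n {b}))) m< ⟩
      2 ^ suc b + 2 ^ suc b       ≡⟨ cong (λ t → 2 ^ suc b + t) (+-identityʳ (2 ^ suc b)) ⟨
      2 ^ (2 + b)                 ≤⟨ ^-monoʳ-≤ 2 (≤-trans (+-monoˡ-≤ b (*-monoʳ-≤ 2 1≤b)) (≤-reflexive (+-comm (2 * b) b))) ⟩
      2 ^ (3 * b)                 ∎
    powers : 2 ^ (8 * b) * (2 ^ (3 * b) * 2 ^ (3 * b) * (2 ^ (3 * b) * 2 ^ (3 * b))) ≡ 2 ^ (20 * b)
    powers rewrite sym (^-distribˡ-+-* 2 (3 * b) (3 * b))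
      | sym (^-distribˡ-+-* 2 (3 * b + 3 * b) (3 * b + 3 * b))
      | sym (^-distribˡ-+-* 2 (8 * b) ((3 * b + 3 * b) + (3 * b + 3 * b))) = cong (2 ^_) (sum b)
      where
      sum : ∀ b → 8 * b + ((3 * b + 3 * b) + (3 * b + 3 * b)) ≡ 20 * b
      sum = solve-∀

  -- With denominators cleared, the last three fields say that r/B is at most 1/e off weight w and
  -- lies between 1/2 - 1/e and 1/2 at w.
  record IntegerApproximation (n w d e : ℕ) : Set where
    field
      B    : ℕ
      H    : ℕ → ℤ
      r    : ℕ → ℕ
      B≢0  : NonZero B
      deg  : Deg≤ d H
      H≡r  : ∀ y → ∃[ j ] (H y ≡ + r y ℤ.+ + B ℤ.* j)
      off  : ∀ y → y ≤ n → y ≢ w → e * r y ≤ B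
      on-≤ : 2 * r w ≤ B
      on-≥ : e * B ≤ 2 * (e * r w) + 2 * B

  integerApproximation : ∀ {n w a′ e} → w ≤ n → .{{NonZero e}} → 2 ≤ a′ → n ≤ 2 ^ a′ → e ≤ 2 ^ a′ →
    IntegerApproximation n w (degree (suc a′) e) e
  integerApproximation {n} {w} {a′} {e} w≤n 2≤a′ n≤ e≤ = record
    { B = B ; H = H ; r = r ; B≢0 = B≢0 ; deg = deg ; H≡r = H≡r
    ; off  = λ y y≤n y≢w → *-cancelˡ-≤ T (≤-trans (off′ y y≤n y≢w) (≤-reflexive (*-comm B T)))
    ; on-≤ = *-cancelˡ-≤ T on-≤′
    ; on-≥ = *-cancelʳ-≤ (e * B) (2 * (e * r w) + 2 * B) Z on-≥′
    }
    where
    open ≤-Reasoning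
    a = suc a′
    qs = fresh (suc (D a e))
    T = length qs
    k = 5 * a
    Z = 2 ^ k

    -- The factors 4, a, a and e of D are each at most 2^a′, the first one because 2 ≤ a′.
    D<2^4a : suc (D a e) ≤ 2 ^ (4 * a)
    D<2^4a = begin
      1 + 4 * a * (a * e)
        ≤⟨ +-mono-≤ (m^n>0 2 (4 * a′)) (*-mono-≤ (*-mono-≤ (^-monoʳ-≤ 2 2≤a′) (n<2^n a′)) (*-mono-≤ (n<2^n a′) e≤)) ⟩
      2 ^ (4 * a′) + 2 ^ a′ * 2 ^ a′ * (2 ^ a′ * 2 ^ a′)
        ≡⟨ cong (λ t → 2 ^ (4 * a′) + t) (fourth a′) ⟩
      2 ^ (4 * a′) + 2 ^ (4 * a′)
        ≡⟨ cong (λ t → 2 ^ (4 * a′) + t) (+-identityʳ (2 ^ (4 * a′))) ⟨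
      2 ^ suc (4 * a′)
        ≤⟨ ^-monoʳ-≤ 2 (≤-trans (m≤m+n (suc (4 * a′)) 3) (≤-reflexive (exponent a′))) ⟩
      2 ^ (4 * a) ∎
      where
      fourth : ∀ m → 2 ^ m * 2 ^ m * (2 ^ m * 2 ^ m) ≡ 2 ^ (4 * m)
      fourth m = trans (sym (cong₂ _*_ (^-distribˡ-+-* 2 m m) (^-distribˡ-+-* 2 m m)))
        (trans (sym (^-distribˡ-+-* 2 (m + m) (m + m))) (cong (2 ^_) (sum m)))
        where
        sum : ∀ m → (m + m) + (m + m) ≡ 4 * m
        sum = solve-∀
      exponent : ∀ m → suc (4 * m) + 3 ≡ 4 * suc m
      exponent = solve-∀

    ae≤T : a * e ≤ T
    ae≤T = *-cancelˡ-≤ (4 * a) (n≤ℓ*#fresh (D a e) (4 * a) D<2^4a)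

    -- The choice k = 5a aims at this: the T rounding errors of 2^(-k) at weight w then add up to at
    -- most 1/e.
    Te≤Z : T * e ≤ Z
    Te≤Z = begin
      T * e                     ≤⟨ *-mono-≤ (≤-trans (length-fresh (suc (D a e))) D<2^4a) e≤ ⟩
      2 ^ (4 * a) * 2 ^ a′      ≡⟨ ^-distribˡ-+-* 2 (4 * a) a′ ⟨
      2 ^ (4 * a + a′)          ≤⟨ ^-monoʳ-≤ 2 (≤-trans (+-monoʳ-≤ (4 * a) (n≤1+n a′)) (≤-reflexive (+-comm (4 * a) a))) ⟩
      2 ^ (5 * a)               ∎

    instance
      _ : NonZero T
      _ = >-nonZero (≤-trans (>-nonZero⁻¹ (a * e) {{m*n≢0 a e}}) ae≤T)
      _ : NonZero Z
      _ = m^n≢0 2 k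

    open Averaging (averaging w k T (D a e) qs (fresh-primePowers (suc (D a e))) (fresh-≤ (suc (D a e))))

    count : ℕ → ℕ
    count y = #divisors qs ∣ y - w ∣

    count-off : ∀ y → y ≤ n → y ≢ w → count y ≤ a
    count-off y y≤n y≢w = #fresh-divisors≤ (suc (D a e)) {{≢-nonZero λ eq → y≢w (∣m-n∣≡0⇒m≡n eq)}} (begin
      ∣ y - w ∣     ≤⟨ ∣m-n∣≤m⊔n y w ⟩
      y ⊔ w         ≤⟨ ⊔-lub y≤n w≤n ⟩
      n             ≤⟨ n≤ ⟩
      2 ^ a′        ≤⟨ ^-monoʳ-≤ 2 (n≤1+n a′) ⟩
      2 ^ a         ∎)

    count-on : count w ≡ T
    count-on = trans (cong (#divisors qs) (∣n-n∣≡0 w)) (#divisors-0 qs)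

    off′ : ∀ y → y ≤ n → y ≢ w → T * (e * r y) ≤ B * T
    off′ y y≤n y≢w = begin
      -- The value off w is even at most a/2T ≤ 1/2e; a factor 2 is given away.
      T * (e * r y)           ≤⟨ m≤n*m (T * (e * r y)) 2 ⟩
      2 * (T * (e * r y))     ≡⟨ regroup T e (r y) ⟩
      2 * T * r y * e         ≤⟨ *-monoˡ-≤ e (upper y) ⟩
      B * count y * e         ≤⟨ *-monoˡ-≤ e (*-monoʳ-≤ B (count-off y y≤n y≢w)) ⟩
      B * a * e               ≡⟨ *-assoc B a e ⟩
      B * (a * e)             ≤⟨ *-monoʳ-≤ B ae≤T ⟩
      B * T                   ∎
      where
      regroup : ∀ T e r → 2 * (T * (e * r)) ≡ 2 * T * r * e
      regroup = solve-∀

    on-≤′ : T * (2 * r w) ≤ T * B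
    on-≤′ = begin
      T * (2 * r w)   ≡⟨ regroup T (r w) ⟩
      2 * T * r w     ≤⟨ upper w ⟩
      B * count w     ≡⟨ cong (B *_) count-on ⟩
      B * T           ≡⟨ *-comm B T ⟩
      T * B           ∎
      where
      regroup : ∀ T r → T * (2 * r) ≡ 2 * T * r
      regroup = solve-∀

    BZ≤ : B * Z ≤ 2 * Z * r w + 2 * B * T
    BZ≤ = *-cancelˡ-≤ T (begin
      T * (B * Z)                                     ≡⟨ regroup T B Z ⟩
      B * T * Z                                       ≡⟨ cong (λ c → B * c * Z) count-on ⟨
      B * count w * Z                                 ≤⟨ lower w ⟩
      2 * T * Z * r w + 2 * T * (B * count w)         ≡⟨ cong (λ c → 2 * T * Z * r w + 2 * T * (B * c)) count-on ⟩
      2 * T * Z * r w + 2 * T * (B * T)               ≡⟨ regroup′ T B Z (r w) ⟩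
      T * (2 * Z * r w + 2 * B * T)                   ∎)
      where
      regroup : ∀ T B Z → T * (B * Z) ≡ B * T * Z
      regroup = solve-∀
      regroup′ : ∀ T B Z r → 2 * T * Z * r + 2 * T * (B * T) ≡ T * (2 * Z * r + 2 * B * T)
      regroup′ = solve-∀

    on-≥′ : e * B * Z ≤ (2 * (e * r w) + 2 * B) * Z
    on-≥′ = begin
      e * B * Z                             ≡⟨ *-assoc e B Z ⟩
      e * (B * Z)                           ≤⟨ *-monoʳ-≤ e BZ≤ ⟩
      e * (2 * Z * r w + 2 * B * T)         ≡⟨ regroup e Z (r w) B T ⟩
      2 * (e * r w) * Z + 2 * B * (T * e)   ≤⟨ +-monoʳ-≤ (2 * (e * r w) * Z) (*-monoʳ-≤ (2 * B) Te≤Z) ⟩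
      2 * (e * r w) * Z + 2 * B * Z         ≡⟨ *-distribʳ-+ Z (2 * (e * r w)) (2 * B) ⟨
      (2 * (e * r w) + 2 * B) * Z           ∎
      where
      regroup : ∀ e Z r B T → e * (2 * Z * r + 2 * B * T) ≡ 2 * (e * r) * Z + 2 * B * (T * e)
      regroup = solve-∀

module Reals (em : ExcludedMiddle 0ℓ) (R : CompleteOrderedField) where
  open import Data.Fin.Subset using (Subset; inside; outside; ∣_∣)
  open import Data.Fin.Subset.Properties using (∣p∣≤n)
  open import Data.Vec.Base using ([]; _∷_)
  open import Data.Rational.Base using (mkℚ)
  open Arithmetic
  open Torus em R
  open CommutativeRing commutativeRing
    using (refl; sym; trans; setoid; ring; +-cong; +-congˡ; +-congʳ; *-congˡ; *-congʳ;
      -‿cong; +-identityˡ; +-identityʳ; *-identityˡ; *-identityʳ; zeroˡ; zeroʳ; -‿inverseʳ; *-comm; *-assoc; reflexive; +-comm; +-assoc; +-monoid)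
  open import Algebra.Properties.Monoid.Mult +-monoid using (×-homo-+)
  open import Algebra.Properties.Semiring.Mult semiring using (×1-homo-*)
  open import Algebra.Properties.Semiring.Exp semiring using (^-assocʳ)
  open import Algebra.Properties.Ring ring using (-0#≈0#; -‿involutive; -‿distribˡ-*; -‿distribʳ-*; -‿+-comm)
  open import Algebra.Construct.NaturalChoice.Max totalOrder using (x≤x⊔y; x≤y⊔x; ⊔-lub)
  open import Data.List.Extrema totalOrder using (max≤v⁺)
  open TotalOrder totalOrder using (total; antisym; ≤-respˡ-≈; ≤-respʳ-≈)
    renaming (refl to ≤-refl; trans to ≤-trans; reflexive to ≤-reflexive)

  -- The embeddings of ℕ and ℤ, and a ring solver with integer coefficients.

  fromℕ-+ : ∀ m n → fromℕ (m ℕ.+ n) ≈ fromℕ m + fromℕ n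
  fromℕ-+ = ×-homo-+ 1#

  fromℕ-* : ∀ m n → fromℕ (m ℕ.* n) ≈ fromℕ m * fromℕ n
  fromℕ-* = ×1-homo-*

  fromℕ-1 : fromℕ 1 ≈ 1#
  fromℕ-1 = +-identityʳ 1#

  private
    [1+x]-[1+y] : ∀ x y → (1# + x) - (1# + y) ≈ x - y
    [1+x]-[1+y] x y = trans (+-congˡ (trans (sym (-‿+-comm 1# y)) (+-comm (- 1#) (- y))))
      (trans (+-cong (+-comm 1# x) refl) (trans (+-assoc x 1# (- y - 1#)) (+-congˡ
        (trans (+-comm 1# (- y - 1#)) (trans (+-assoc (- y) (- 1#) 1#)
          (trans (+-congˡ (trans (+-comm (- 1#) 1#) (-‿inverseʳ 1#))) (+-identityʳ (- y))))))))

  fromℤ-⊖ : ∀ m n → fromℤ (m ℤ.⊖ n) ≈ fromℕ m - fromℕ n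
  fromℤ-⊖ m zero rewrite ℤ.⊖-≥ {m} {0} ℕ.z≤n = sym (trans (+-congˡ -0#≈0#) (+-identityʳ (fromℕ m)))
  fromℤ-⊖ zero (suc n) = sym (+-identityˡ (- fromℕ (suc n)))
  fromℤ-⊖ (suc m) (suc n) rewrite ℤ.[1+m]⊖[1+n]≡m⊖n m n =
    trans (fromℤ-⊖ m n) (sym ([1+x]-[1+y] (fromℕ m) (fromℕ n)))

  fromℤ-neg : ∀ i → fromℤ (ℤ.- i) ≈ - fromℤ i
  fromℤ-neg (+ zero)  = sym -0#≈0#
  fromℤ-neg (+ suc n) = refl
  fromℤ-neg -[1+ n ]  = sym (-‿involutive (fromℕ (suc n)))

  fromℤ-+ : ∀ i j → fromℤ (i ℤ.+ j) ≈ fromℤ i + fromℤ j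
  fromℤ-+ (+ m)    (+ n)    = fromℕ-+ m n
  fromℤ-+ (+ m)    -[1+ n ] = fromℤ-⊖ m (suc n)
  fromℤ-+ -[1+ m ] (+ n)    = trans (fromℤ-⊖ n (suc m)) (+-comm (fromℕ n) (- fromℕ (suc m)))
  fromℤ-+ -[1+ m ] -[1+ n ] = trans (-‿cong
      (trans (reflexive (≡.cong fromℕ (≡.cong suc (≡.sym (ℕ.+-suc m n))))) (fromℕ-+ (suc m) (suc n))))
    (sym (-‿+-comm (fromℕ (suc m)) (fromℕ (suc n))))

  fromℤ-*ℕ : ∀ i n → fromℤ (i ℤ.* + n) ≈ fromℤ i * fromℕ n
  fromℤ-*ℕ (+ m) n = trans (reflexive (≡.cong fromℤ (≡.sym (ℤ.pos-* m n)))) (fromℕ-* m n)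
  fromℤ-*ℕ -[1+ m ] n = trans (reflexive (≡.cong fromℤ (≡.sym (ℤ.neg-distribˡ-* (+ suc m) (+ n)))))
    (trans (fromℤ-neg (+ suc m ℤ.* + n)) (trans (-‿cong (fromℤ-*ℕ (+ suc m) n)) (-‿distribˡ-* (fromℕ (suc m)) (fromℕ n))))

  fromℤ-* : ∀ i j → fromℤ (i ℤ.* j) ≈ fromℤ i * fromℤ j
  fromℤ-* i (+ n)    = fromℤ-*ℕ i n
  fromℤ-* i -[1+ n ] = trans (reflexive (≡.cong fromℤ (≡.sym (ℤ.neg-distribʳ-* i (+ suc n)))))
    (trans (fromℤ-neg (i ℤ.* + suc n)) (trans (-‿cong (fromℤ-*ℕ i (suc n))) (-‿distribʳ-* (fromℤ i) (fromℕ (suc n)))))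

  private
    open import Algebra.Solver.Ring.AlmostCommutativeRing
      using (fromCommutativeRing; _-Raw-AlmostCommutative⟶_)
    fromℤ-morphism : CommutativeRing.rawRing ℤ.+-*-commutativeRing -Raw-AlmostCommutative⟶ fromCommutativeRing commutativeRing
    fromℤ-morphism = record
      { ⟦_⟧ = fromℤ
      ; +-homo = fromℤ-+
      ; *-homo = fromℤ-*
      ; -‿homo = fromℤ-neg
      ; 0-homo = refl
      ; 1-homo = fromℕ-1
      }

  open import Algebra.Solver.Ring
    (CommutativeRing.rawRing ℤ.+-*-commutativeRing) (fromCommutativeRing commutativeRing) fromℤ-morphism
    (λ i j → Maybe.map (λ i≡j → reflexive (≡.cong fromℤ i≡j)) (dec⇒weaklyDec ℤ._≟_ i j))
    using (solve; _:=_; _:+_; _:*_; _:-_; :-_; _:^_; con; Polynomial)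

  -- The constant coefficient 1ℤ denotes 1# + 0#; the empty power denotes 1# itself.
  :1 : ∀ {n} → Polynomial n
  :1 = con (+ 0) :^ 0

  -- Ordered field arithmetic.

  0≤⇒≤ : ∀ {x y} → 0# ≤ y - x → x ≤ y
  0≤⇒≤ {x} {y} 0≤y-x = ≤-respʳ-≈ (solve 2 (λ x y → (y :- x) :+ x := y) refl x y)
    (≤-respˡ-≈ (+-identityˡ x) (+-monoˡ-≤ x 0≤y-x))

  ≤⇒0≤ : ∀ {x y} → x ≤ y → 0# ≤ y - x
  ≤⇒0≤ {x} x≤y = ≤-respˡ-≈ (-‿inverseʳ x) (+-monoˡ-≤ (- x) x≤y)

  0≤-+ : ∀ {x y} → 0# ≤ x → 0# ≤ y → 0# ≤ x + y
  0≤-+ {x} {y} 0≤x 0≤y = ≤-trans 0≤y (≤-respˡ-≈ (+-identityˡ y) (+-monoˡ-≤ y 0≤x))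

  -- The standard way to prove inequalities below: e is assembled from nonnegative pieces, and the
  -- ring solver checks the identity.
  linear : ∀ {x y e} → 0# ≤ e → y - x ≈ e → x ≤ y
  linear 0≤e y-x≈e = 0≤⇒≤ (≤-respʳ-≈ (sym y-x≈e) 0≤e)

  +-mono-≤ : ∀ {x y u v} → x ≤ y → u ≤ v → x + u ≤ y + v
  +-mono-≤ {x} {y} {u} {v} x≤y u≤v = linear (0≤-+ (≤⇒0≤ x≤y) (≤⇒0≤ u≤v))
    (solve 4 (λ x y u v → (y :+ v) :- (x :+ u) := (y :- x) :+ (v :- u)) refl x y u v)

  neg-anti-≤ : ∀ {x y} → x ≤ y → - y ≤ - x
  neg-anti-≤ {x} {y} x≤y = linear (≤⇒0≤ x≤y) (solve 2 (λ x y → :- x :- :- y := y :- x) refl x y)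

  *-monoˡ-≤ : ∀ {x y} z → 0# ≤ z → x ≤ y → z * x ≤ z * y
  *-monoˡ-≤ {x} {y} z 0≤z x≤y = linear (*-nonNeg 0≤z (≤⇒0≤ x≤y))
    (solve 3 (λ x y z → z :* y :- z :* x := z :* (y :- x)) refl x y z)

  *-monoʳ-≤ : ∀ {x y} z → 0# ≤ z → x ≤ y → x * z ≤ y * z
  *-monoʳ-≤ {x} {y} z 0≤z x≤y = linear (*-nonNeg 0≤z (≤⇒0≤ x≤y))
    (solve 3 (λ x y z → y :* z :- x :* z := z :* (y :- x)) refl x y z)

  0≤1 : 0# ≤ 1#
  0≤1 with total 0# 1#
  ... | inj₁ 0≤1 = 0≤1
  ... | inj₂ 1≤0 = ≤-respʳ-≈ (solve 0 (:- :1 :* :- :1 := :1) refl) (*-nonNeg 0≤-1 0≤-1)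
    where
    0≤-1 : 0# ≤ - 1#
    0≤-1 = ≤-respˡ-≈ -0#≈0# (neg-anti-≤ 1≤0)

  1≰0 : ¬ 1# ≤ 0#
  1≰0 1≤0 = 0≉1 (antisym 0≤1 1≤0)

  fromℕ-nonNeg : ∀ n → 0# ≤ fromℕ n
  fromℕ-nonNeg zero    = ≤-refl
  fromℕ-nonNeg (suc n) = 0≤-+ 0≤1 (fromℕ-nonNeg n)

  fromℕ-mono-≤ : ∀ {m n} → m ℕ.≤ n → fromℕ m ≤ fromℕ n
  fromℕ-mono-≤ {n = n} ℕ.z≤n = fromℕ-nonNeg n
  fromℕ-mono-≤ (ℕ.s≤s m≤n)   = +-mono-≤ ≤-refl (fromℕ-mono-≤ m≤n)

  fromℕ-cancel-≤ : ∀ {m n} → fromℕ m ≤ fromℕ n → m ℕ.≤ n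
  fromℕ-cancel-≤ {m} {n} fm≤fn = ℕ.≮⇒≥ λ n<m → 1≰0
    (linear (≤⇒0≤ (≤-trans (fromℕ-mono-≤ n<m) fm≤fn))
      (solve 1 (λ n → con (+ 0) :- :1 := n :- (:1 :+ n)) refl (fromℕ n)))

  1≤fromℕ : ∀ n → .{{ℕ.NonZero n}} → 1# ≤ fromℕ n
  1≤fromℕ n = ≤-respˡ-≈ fromℕ-1 (fromℕ-mono-≤ (ℕ.>-nonZero⁻¹ n))

  1≤⇒0< : ∀ {x} → 1# ≤ x → 0# < x
  1≤⇒0< 1≤x = ≤-trans 0≤1 1≤x , λ 0≈x → 1≰0 (≤-respʳ-≈ (sym 0≈x) 1≤x)

  0<fromℕ : ∀ n → .{{ℕ.NonZero n}} → 0# < fromℕ n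
  0<fromℕ n = 1≤⇒0< (1≤fromℕ n)

  ⁻¹-inverse : ∀ {x} → 0# < x → x * x ⁻¹ ≈ 1#
  ⁻¹-inverse {x} (_ , 0≉x) = *-inverseʳ x (λ x≈0 → 0≉x (sym x≈0))

  ⁻¹-nonNeg : ∀ {x} → 0# < x → 0# ≤ x ⁻¹
  ⁻¹-nonNeg {x} 0<x with total 0# (x ⁻¹)
  ... | inj₁ 0≤x⁻¹ = 0≤x⁻¹
  ... | inj₂ x⁻¹≤0 = ⊥-elim (1≰0 (≤-respˡ-≈ (⁻¹-inverse 0<x) (≤-respʳ-≈ (zeroʳ x) (*-monoˡ-≤ x (proj₁ 0<x) x⁻¹≤0))))

  /-*-cancel : ∀ {x y} → 0# < y → x / y * y ≈ x
  /-*-cancel {x} {y} 0<y = trans (solve 3 (λ x y i → x :* i :* y := x :* (y :* i)) refl x y (y ⁻¹))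
    (trans (*-congˡ (⁻¹-inverse 0<y)) (*-identityʳ x))

  *-/-cancel : ∀ {x y} → 0# < y → x * y / y ≈ x
  *-/-cancel {x} {y} 0<y = trans (*-assoc x y (y ⁻¹)) (trans (*-congˡ (⁻¹-inverse 0<y)) (*-identityʳ x))

  *-cancelʳ-≤ : ∀ {x y z} → 0# < z → x * z ≤ y * z → x ≤ y
  *-cancelʳ-≤ {x} {y} {z} 0<z xz≤yz = ≤-respˡ-≈ (*-/-cancel 0<z) (≤-respʳ-≈ (*-/-cancel 0<z)
    (*-monoʳ-≤ (z ⁻¹) (⁻¹-nonNeg 0<z) xz≤yz))

  *-cancelˡ-≤ : ∀ {x y z} → 0# < z → z * x ≤ z * y → x ≤ y
  *-cancelˡ-≤ {x} {y} {z} 0<z zx≤zy = *-cancelʳ-≤ 0<z (≤-respˡ-≈ (*-comm z x) (≤-respʳ-≈ (*-comm z y) zx≤zy))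

  ≤*⇒/≤ : ∀ {x y z} → 0# < z → x ≤ y * z → x / z ≤ y
  ≤*⇒/≤ 0<z x≤yz = *-cancelʳ-≤ 0<z (≤-respˡ-≈ (sym (/-*-cancel 0<z)) x≤yz)

  *≤⇒≤/ : ∀ {x y z} → 0# < z → x * z ≤ y → x ≤ y / z
  *≤⇒≤/ 0<z xz≤y = *-cancelʳ-≤ 0<z (≤-respʳ-≈ (sym (/-*-cancel 0<z)) xz≤y)

  /≤⇒≤* : ∀ {x y z} → 0# < z → x / z ≤ y → x ≤ y * z
  /≤⇒≤* {z = z} 0<z x/z≤y = ≤-respˡ-≈ (/-*-cancel 0<z) (*-monoʳ-≤ z (proj₁ 0<z) x/z≤y)

  -- Absolute value and distance to the nearest integer.

  x≤abs : ∀ x → x ≤ abs x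
  x≤abs x = x≤x⊔y x (- x)

  -x≤abs : ∀ x → - x ≤ abs x
  -x≤abs x = x≤y⊔x x (- x)

  abs-≤ : ∀ {x c} → x ≤ c → - x ≤ c → abs x ≤ c
  abs-≤ = ⊔-lub

  0≤abs : ∀ x → 0# ≤ abs x
  0≤abs x with total 0# x
  ... | inj₁ 0≤x = ≤-trans 0≤x (x≤abs x)
  ... | inj₂ x≤0 = ≤-trans (≤-respˡ-≈ -0#≈0# (neg-anti-≤ x≤0)) (-x≤abs x)

  ½+½≈1 : ½ + ½ ≈ 1#
  ½+½≈1 = trans (solve 1 (λ h → h :+ h := h :* con (+ 2)) refl ½) (/-*-cancel {1#} {fromℕ 2} (0<fromℕ 2))

  ½≤-v : ∀ {u v i} → u ≤ ½ → u - v ≈ 1# + i → 0# ≤ i → ½ ≤ - v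
  ½≤-v {u} {v} {i} u≤½ u-v≈ 0≤i = linear (0≤-+ (≤⇒0≤ u≤½) 0≤i)
    (trans (solve 3 (λ u v h → :- v :- h := (h :- u) :+ (u :- v) :- (h :+ h)) refl u v ½)
    (trans (+-cong (+-congˡ u-v≈) (-‿cong ½+½≈1))
    (solve 3 (λ h u i → (h :- u) :+ (:1 :+ i) :- :1 := (h :- u) :+ i) refl ½ u i)))

  -- Two representatives u and v of z differ by an integer. If it is nonzero, then u in [-1/2, 1/2)
  -- forces ∣v∣ ≥ 1/2 ≥ ∣u∣. Thus any convenient j gives an upper bound.
  ∣mod1∣≤abs : ∀ z j → ∣ z mod1∣ ≤ abs (z - fromℤ j)
  ∣mod1∣≤abs z j with em {∃[ k ] (- ½ ≤ z - fromℤ k × z - fromℤ k < ½)}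
  -- Here `ι z` has its default value 0, which is below any absolute value.
  ... | no _ = abs-≤ (0≤abs (z - fromℤ j)) (≤-respˡ-≈ (sym -0#≈0#) (0≤abs (z - fromℤ j)))
  ... | yes (k , -½≤u , u<½) = compare (j ℤ.- k) difference
    where
    u = z - fromℤ k
    v = z - fromℤ j
    -u≤½ : - u ≤ ½
    -u≤½ = ≤-respʳ-≈ (-‿involutive ½) (neg-anti-≤ -½≤u)
    ∣u∣≤½ : abs u ≤ ½
    ∣u∣≤½ = abs-≤ (proj₁ u<½) -u≤½
    difference : u - v ≈ fromℤ (j ℤ.- k)
    difference = trans (solve 3 (λ z j k → (z :- k) :- (z :- j) := j :- k) refl z (fromℤ j) (fromℤ k))
      (sym (trans (fromℤ-+ j (ℤ.- k)) (+-congˡ (fromℤ-neg k))))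
    compare : ∀ i → u - v ≈ fromℤ i → abs u ≤ abs v
    compare (+ zero) u-v≈0 = abs-≤ (≤-respˡ-≈ (sym u≈v) (x≤abs v)) (≤-respˡ-≈ (-‿cong (sym u≈v)) (-x≤abs v))
      where
      u≈v : u ≈ v
      u≈v = trans (solve 2 (λ u v → u := (u :- v) :+ v) refl u v) (trans (+-congʳ u-v≈0) (+-identityˡ v))
    compare (+ suc i) u-v≈ = ≤-trans ∣u∣≤½ (≤-trans (½≤-v (proj₁ u<½) u-v≈ (fromℕ-nonNeg i)) (-x≤abs v))
    compare -[1+ i ] u-v≈ = ≤-trans ∣u∣≤½ (≤-trans (≤-respʳ-≈ (-‿involutive v) (½≤-v -u≤½ negated (fromℕ-nonNeg i))) (x≤abs v))
      where
      negated : - u - - v ≈ 1# + fromℕ i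
      negated = trans (solve 2 (λ u v → :- u :- :- v := :- (u :- v)) refl u v)
        (trans (-‿cong u-v≈) (-‿involutive (1# + fromℕ i)))

  -- Powers, the Archimedean property and suprema.

  ^-nonNeg : ∀ {x} n → 0# ≤ x → 0# ≤ x ^ n
  ^-nonNeg zero    _   = 0≤1
  ^-nonNeg (suc n) 0≤x = *-nonNeg 0≤x (^-nonNeg n 0≤x)

  1≤^ : ∀ {x} n → 1# ≤ x → 1# ≤ x ^ n
  1≤^ zero _ = ≤-refl
  1≤^ {x} (suc n) 1≤x = ≤-trans 1≤x (≤-respˡ-≈ (*-identityʳ x) (*-monoˡ-≤ x (≤-trans 0≤1 1≤x) (1≤^ n 1≤x)))

  ^-monoˡ-≤ : ∀ {x y} n → 0# ≤ x → x ≤ y → x ^ n ≤ y ^ n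
  ^-monoˡ-≤ zero _ _ = ≤-refl
  ^-monoˡ-≤ {x} {y} (suc n) 0≤x x≤y = ≤-trans (*-monoʳ-≤ (x ^ n) (^-nonNeg n 0≤x) x≤y)
    (*-monoˡ-≤ y (≤-trans 0≤x x≤y) (^-monoˡ-≤ n 0≤x x≤y))

  ^-cancelˡ-≤ : ∀ {x y} n → 0# ≤ x → 1# ≤ y → x ^ suc n ≤ y ^ suc n → x ≤ y
  ^-cancelˡ-≤ {x} {y} n 0≤x 1≤y x^≤y^ with total x y
  ... | inj₁ x≤y = x≤y
  ... | inj₂ y≤x = *-cancelʳ-≤ (1≤⇒0< (1≤^ n 1≤y))
    (≤-trans (*-monoˡ-≤ x 0≤x (^-monoˡ-≤ n (≤-trans 0≤1 1≤y) y≤x)) x^≤y^)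

  fromℕ-^ : ∀ m n → fromℕ (m ℕ.^ n) ≈ fromℕ m ^ n
  fromℕ-^ m zero    = fromℕ-1
  fromℕ-^ m (suc n) = trans (fromℕ-* m (m ℕ.^ n)) (*-congˡ (fromℕ-^ m n))

  -- Otherwise x bounds the natural numbers, which then have a supremum s. Since n + 1 ≤ s for all
  -- n, also s - 1 is an upper bound.
  archimedean : ∀ x → ∃[ n ] x ≤ fromℕ n
  archimedean x with em {∃[ n ] x ≤ fromℕ n}
  ... | yes bound = bound
  ... | no unbounded = ⊥-elim (1≰0 (linear (≤⇒0≤ (least (s - 1#) s-1-bound))
      (solve 1 (λ s → con (+ 0) :- :1 := (s :- :1) :- s) refl s)))
    where
    S : ℝ → Set
    S y = ∃[ n ] y ≈ fromℕ n
    bounded : IsUpperBound S x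
    bounded y (n , y≈n) with total x (fromℕ n)
    ... | inj₁ x≤n = ⊥-elim (unbounded (n , x≤n))
    ... | inj₂ n≤x = ≤-respˡ-≈ (sym y≈n) n≤x
    supremum = complete S (0# , 0 , refl) (x , bounded)
    s = proj₁ supremum
    least = proj₂ (proj₂ supremum)
    s-1-bound : IsUpperBound S (s - 1#)
    s-1-bound y (n , y≈n) = linear (≤⇒0≤ (proj₁ (proj₂ supremum) (fromℕ (suc n)) (suc n , refl)))
      (trans (+-congˡ (-‿cong y≈n)) (solve 2 (λ s n → (s :- :1) :- n := s :- (:1 :+ n)) refl s (fromℕ n)))

  -- The assumption 0 ≤ u takes care of the default value 0, taken when S is empty.
  sup-≤ : ∀ S {u} → 0# ≤ u → IsUpperBound S u → sup S ≤ u
  sup-≤ S {u} 0≤u bound with em {∃ S × ∃ (IsUpperBound S)}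
  ... | yes (nonempty , bounded) = proj₂ (proj₂ (complete S nonempty bounded)) u bound
  ... | no  _                    = 0≤u

  ≤-sup : ∀ S {x u} → IsUpperBound S u → S x → x ≤ sup S
  ≤-sup S {x} {u} bound Sx with em {∃ S × ∃ (IsUpperBound S)}
  ... | yes (nonempty , bounded) = proj₁ (proj₂ (complete S nonempty bounded)) x Sx
  ... | no  ¬bounded             = ⊥-elim (¬bounded ((x , Sx) , (u , bound)))

  sup-nonNeg : ∀ S → (∀ x → S x → 0# ≤ x) → 0# ≤ sup S
  sup-nonNeg S S≥0 with em {∃ S × ∃ (IsUpperBound S)}
  ... | yes ((x , Sx) , bounded) = ≤-trans (S≥0 x Sx) (proj₁ (proj₂ (complete S (x , Sx) bounded)) x Sx)
  ... | no  _                    = ≤-refl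

  -- Estimates for `exp₂`, `log₂` and `pow` at integers.

  ⁻¹≤1 : ∀ {x} → 1# ≤ x → x ⁻¹ ≤ 1#
  ⁻¹≤1 {x} 1≤x = ≤-respˡ-≈ (*-identityˡ (x ⁻¹)) (≤-respʳ-≈ (⁻¹-inverse 0<x) (*-monoʳ-≤ (x ⁻¹) (⁻¹-nonNeg 0<x) 1≤x))
    where
    0<x = 1≤⇒0< 1≤x

  1≤2 : 1# ≤ fromℕ 2
  1≤2 = 1≤fromℕ 2

  -- For r = p/q one has z^q = 2^p ≤ (2^N)^q, because p ≤ Nq; then the q-th power is cancelled. For
  -- negative p the power 2^p is at most 1.
  Is2^ℚ-≤ : ∀ {N} r {z} → fromℚ r ≤ fromℕ N → Is2^ℚ r z → z ≤ fromℕ 2 ^ N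
  Is2^ℚ-≤ {N} (mkℚ p d _) {z} p/q≤N (0≤z , z^q≈) = ^-cancelˡ-≤ d 0≤z (1≤^ N 1≤2)
    (≤-respˡ-≈ (sym z^q≈) (bound p p≤N*q))
    where
    p≤N*q : fromℤ p ≤ fromℕ N * fromℕ (suc d)
    p≤N*q = /≤⇒≤* (0<fromℕ (suc d)) p/q≤N
    bound : ∀ p → fromℤ p ≤ fromℕ N * fromℕ (suc d) → 2^ℤ p ≤ (fromℕ 2 ^ N) ^ suc d
    bound (+ m) m≤ = ≤-respˡ-≈ (fromℕ-^ 2 m) (≤-respʳ-≈ (trans (fromℕ-^ 2 (N ℕ.* suc d)) (sym (^-assocʳ (fromℕ 2) N (suc d))))
      (fromℕ-mono-≤ (ℕ.^-monoʳ-≤ 2 (fromℕ-cancel-≤ {m} {N ℕ.* suc d} (≤-respʳ-≈ (sym (fromℕ-* N (suc d))) m≤)))))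
    bound -[1+ m ] _ = ≤-trans (⁻¹≤1 (1≤^ (suc m) 1≤2)) (1≤^ (suc d) (1≤^ N 1≤2))

  exp₂-≤ : ∀ {y} N → y ≤ fromℕ N → exp₂ y ≤ fromℕ 2 ^ N
  exp₂-≤ {y} N y≤N = sup-≤ (λ z → ∃[ r ] (fromℚ r ≤ y × Is2^ℚ r z)) (≤-trans 0≤1 (1≤^ N 1≤2))
    λ z (r , r≤y , z≈2^r) → Is2^ℚ-≤ {N} r (≤-trans r≤y y≤N) z≈2^r

  -- The power 2^m belongs to the set through r = m/1. An integer N ≥ y provides the upper bound
  -- without which `sup` would take its default value.
  ≤-exp₂ : ∀ {y} m → fromℕ m ≤ y → fromℕ 2 ^ m ≤ exp₂ y
  ≤-exp₂ {y} m m≤y with archimedean y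
  ... | N , y≤N = ≤-sup (λ z → ∃[ r ] (fromℚ r ≤ y × Is2^ℚ r z))
    (λ z (r , r≤y , z≈2^r) → Is2^ℚ-≤ {N} r (≤-trans r≤y y≤N) z≈2^r)
    (m/1 , ≤-trans (≤*⇒/≤ (0<fromℕ 1) (≤-reflexive (sym (trans (*-congˡ fromℕ-1) (*-identityʳ (fromℕ m)))))) m≤y ,
      ≤-trans 0≤1 (1≤^ m 1≤2) , *-identityʳ (fromℕ 2 ^ m))
    where
    m/1 = mkℚ (+ m) 0 (Coprime.sym (Coprime.1-coprimeTo m))

  exp₂-nonNeg : ∀ y → 0# ≤ exp₂ y
  exp₂-nonNeg y = sup-nonNeg (λ z → ∃[ r ] (fromℚ r ≤ y × Is2^ℚ r z)) λ z (_ , _ , 0≤z , _) → 0≤z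

  -- An integer N ≥ x bounds the set: some y ≥ N in it would give 2^N ≤ `exp₂ y` ≤ x ≤ N.
  ≤-log₂ : ∀ {x} m → fromℕ 2 ^ m ≤ x → fromℕ m ≤ log₂ x
  ≤-log₂ {x} m 2^m≤x with archimedean x
  ... | N , x≤N = ≤-sup (λ y → exp₂ y ≤ x) bound (≤-trans (exp₂-≤ m ≤-refl) 2^m≤x)
    where
    bound : IsUpperBound (λ y → exp₂ y ≤ x) (fromℕ N)
    bound y 2^y≤x with total y (fromℕ N)
    ... | inj₁ y≤N = y≤N
    ... | inj₂ N≤y = ⊥-elim (ℕ.<⇒≱ (n<2^n N) (fromℕ-cancel-≤
          (≤-respˡ-≈ (sym (fromℕ-^ 2 N)) (≤-trans (≤-exp₂ N N≤y) (≤-trans 2^y≤x x≤N)))))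

  ≤-pow : ∀ {x} b c → fromℕ (2 ℕ.^ b) ≤ x → fromℕ (2 ℕ.^ (c ℕ.* b)) ≤ pow x (fromℕ c)
  ≤-pow b c 2^b≤x = ≤-respˡ-≈ (sym (fromℕ-^ 2 (c ℕ.* b))) (≤-exp₂ (c ℕ.* b)
    (≤-respˡ-≈ (sym (fromℕ-* c b)) (*-monoˡ-≤ (fromℕ c) (fromℕ-nonNeg c)
      (≤-log₂ b (≤-respˡ-≈ (fromℕ-^ 2 b) 2^b≤x)))))

  -- From integer functions of the weight to symmetric torus polynomials.

  sum-++ : ∀ xs ys → sum (xs ++ ys) ≈ sum xs + sum ys
  sum-++ []       ys = sym (+-identityˡ (sum ys))
  sum-++ (x ∷ xs) ys = trans (+-congˡ (sum-++ xs ys)) (sym (+-assoc x (sum xs) (sum ys)))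

  sum-map-cong : ∀ {A : Set} {f g : A → ℝ} → (∀ x → f x ≈ g x) → ∀ xs → sum (map f xs) ≈ sum (map g xs)
  sum-map-cong f≈g []       = refl
  sum-map-cong f≈g (x ∷ xs) = +-cong (f≈g x) (sum-map-cong f≈g xs)

  sum-map-* : ∀ {A : Set} (f : A → ℝ) a xs → sum (map (λ x → a * f x) xs) ≈ a * sum (map f xs)
  sum-map-* f a []       = sym (zeroʳ a)
  sum-map-* f a (x ∷ xs) = trans (+-congˡ (sum-map-* f a xs))
    (solve 3 (λ a u v → a :* u :+ a :* v := a :* (u :+ v)) refl a (f x) (sum (map f xs)))

  sum-filter : ∀ {A : Set} {P : A → Set} (P? : ∀ x → Dec (P x)) {f : A → ℝ} →
               (∀ x → ¬ P x → f x ≈ 0#) → ∀ xs → sum (map f (filter P? xs)) ≈ sum (map f xs)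
  sum-filter P? f≈0 [] = refl
  sum-filter P? {f} f≈0 (x ∷ xs) with P? x
  ... | yes _  = +-congˡ (sum-filter P? f≈0 xs)
  ... | no ¬Px = trans (sum-filter P? f≈0 xs) (sym (trans (+-congʳ (f≈0 x ¬Px)) (+-identityˡ (sum (map f xs)))))

  -- Newton's forward difference formula, as C(∣x∣, j) = Σ_{∣S∣ = j} ∏_{i ∈ S} xᵢ.
  newton : ∀ {n} (f : ℕ → ℤ) (x : Cube n) →
           sum (map (λ S → fromℤ (δ^ ∣ S ∣ f 0) * monomial S x) (cube n)) ≈ fromℤ (f ∣ x ∣)
  newton f [] = trans (+-identityʳ (fromℤ (f 0) * 1#)) (*-identityʳ (fromℤ (f 0)))
  newton {suc n} f (b ∷ x) = begin
    sum (map term (map (outside ∷_) (cube n) ++ map (inside ∷_) (cube n)))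
      ≡⟨ ≡.cong sum (map-++ term (map (outside ∷_) (cube n)) (map (inside ∷_) (cube n))) ⟩
    sum (map term (map (outside ∷_) (cube n)) ++ map term (map (inside ∷_) (cube n)))
      ≈⟨ sum-++ (map term (map (outside ∷_) (cube n))) (map term (map (inside ∷_) (cube n))) ⟩
    sum (map term (map (outside ∷_) (cube n))) + sum (map term (map (inside ∷_) (cube n)))
      ≡⟨ ≡.cong₂ (λ us vs → sum us + sum vs) (map-∘ (cube n)) (map-∘ (cube n)) ⟨
    sum (map (λ S → term (outside ∷ S)) (cube n)) + sum (map (λ S → term (inside ∷ S)) (cube n))
      -- Subsets without the first coordinate give the formula for f, those with it the formula for
      -- δ f times the first bit.
      ≈⟨ +-cong (newton f x) (trans (sum-map-cong
          (λ S → solve 3 (λ u v w → u :* (v :* w) := v :* (u :* w)) refl (fromℤ (δ^ ∣ S ∣ (δ f) 0)) (fromBool b) (monomial S x)) (cube n))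
          (trans (sum-map-* (λ S → fromℤ (δ^ ∣ S ∣ (δ f) 0) * monomial S x) (fromBool b) (cube n)) (*-congˡ (newton (δ f) x)))) ⟩
    fromℤ (f ∣ x ∣) + fromBool b * fromℤ (δ f ∣ x ∣)
      ≈⟨ step b ⟩
    fromℤ (f ∣ b ∷ x ∣) ∎
    where
    open SetoidReasoning setoid
    term : Subset (suc n) → ℝ
    term S = fromℤ (δ^ ∣ S ∣ f 0) * monomial S (b ∷ x)
    step : ∀ b → fromℤ (f ∣ x ∣) + fromBool b * fromℤ (δ f ∣ x ∣) ≈ fromℤ (f ∣ b ∷ x ∣)
    step false = trans (+-congˡ (zeroˡ (fromℤ (δ f ∣ x ∣)))) (+-identityʳ (fromℤ (f ∣ x ∣)))
    step true  = trans (+-congˡ (*-identityˡ (fromℤ (δ f ∣ x ∣)))) (trans (sym (fromℤ-+ (f ∣ x ∣) (δ f ∣ x ∣)))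
      (reflexive (≡.cong fromℤ (telescope (f ∣ x ∣) (f (suc ∣ x ∣))))))
      where
      telescope : ∀ u v → u ℤ.+ (v ℤ.- u) ≡ v
      telescope = ℤ-Solver.solve-∀

  -- The Newton coefficients depend only on ∣S∣ and vanish for ∣S∣ > d, so truncating the expansion
  -- at degree d loses nothing.
  Deg≤⇒symmetric : ∀ {n d f} (a : ℝ) → Deg≤ d f → IsSymmetricTorusPolynomial {n} d (λ x → a * fromℤ (f ∣ x ∣))
  Deg≤⇒symmetric {n} {d} {f} a deg = (λ S → a * fromℤ (δ^ ∣ S ∣ f 0)) ,
    (λ S T ∣S∣≡∣T∣ → reflexive (≡.cong (λ j → a * fromℤ (δ^ j f 0)) ∣S∣≡∣T∣)) ,
    λ x → + 0 , trans (+-congʳ (sym (eval x))) (-‿inverseʳ (evalPoly d _ x))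
    where
    eval : ∀ x → evalPoly d (λ S → a * fromℤ (δ^ ∣ S ∣ f 0)) x ≈ a * fromℤ (f ∣ x ∣)
    eval x = trans (sum-filter (λ S → ∣ S ∣ ℕ.≤? d) vanish (cube n))
      (trans (sum-map-cong (λ S → *-assoc a (fromℤ (δ^ ∣ S ∣ f 0)) (monomial S x)) (cube n))
      (trans (sum-map-* (λ S → fromℤ (δ^ ∣ S ∣ f 0) * monomial S x) a (cube n)) (*-congˡ (newton f x))))
      where
      vanish : ∀ S → ¬ ∣ S ∣ ℕ.≤ d → a * fromℤ (δ^ ∣ S ∣ f 0) * monomial S x ≈ 0#
      vanish S S≰d = trans (*-congʳ (trans (*-congˡ (reflexive (≡.cong fromℤ (δ^-vanishes deg (ℕ.≰⇒> S≰d) 0)))) (zeroʳ a)))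
        (zeroˡ (monomial S x))

  ‖mod1‖≤ : ∀ {n} (F : Cube n → 𝕋) {ε} → 0# ≤ ε → (∀ x → ∃[ j ] abs (F x - fromℤ j) ≤ ε) → ‖ F mod1‖∞ ≤ ε
  ‖mod1‖≤ {n} F 0≤ε near = max≤v⁺ 0≤ε (All.map⁺ (All.universal
    (λ x → ≤-trans (∣mod1∣≤abs (F x) (proj₁ (near x))) (proj₂ (near x))) (cube n)))

  -- A discrete intermediate value principle for arbitrary predicates. It supplies least witnesses,
  -- ⌈1/ε⌉ and the floors of logarithms.
  crossing : (P : ℕ → Set) → P 0 → ∀ n → ¬ P n → ∃[ k ] (P k × ¬ P (suc k))
  crossing P P0 zero    ¬P0 = ⊥-elim (¬P0 P0)
  crossing P P0 (suc n) ¬P1+n with em {P n}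
  ... | yes Pn = n , Pn , ¬P1+n
  ... | no ¬Pn = crossing P P0 n ¬Pn

  least : ∀ {P : ℕ → Set} {d} → P d → ∃[ d′ ] (d′ ℕ.≤ d × P d′ × (∀ d″ → P d″ → d′ ℕ.≤ d″))
  least {P} {d} Pd with em {P 0}
  ... | yes P0 = 0 , ℕ.z≤n , P0 , λ _ _ → ℕ.z≤n
  -- The property that no witness occurs up to k first fails at the least witness, which excluded
  -- middle then extracts.
  ... | no ¬P0 with crossing (λ k → ∀ j → j ℕ.≤ k → ¬ P j) (λ { .0 ℕ.z≤n → ¬P0 }) d (λ none → none d ℕ.≤-refl Pd)
  ...   | k , none , some = suc k , ℕ.≮⇒≥ (λ d<1+k → none d (ℕ.≤-pred d<1+k) Pd) ,
    decidable-stable em (λ ¬P → some λ j j≤1+k Pj → ¬P (≡.subst P (ℕ.≤-antisym j≤1+k (ℕ.≮⇒≥ λ j<1+k → none j (ℕ.≤-pred j<1+k) Pj)) Pj)) ,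
    λ j Pj → ℕ.≮⇒≥ λ j<1+k → none j (ℕ.≤-pred j<1+k) Pj

  ≰⇒≥ : ∀ {x y} → ¬ x ≤ y → y ≤ x
  ≰⇒≥ {x} {y} x≰y with total x y
  ... | inj₁ x≤y = ⊥-elim (x≰y x≤y)
  ... | inj₂ y≤x = y≤x

  -- The case ε ≥ 1/4.

  C : ℝ
  C = fromℕ 20

  SymmetricApproximation : ℕ → ℕ → ℝ → Set
  SymmetricApproximation n w ε =
    ∃[ d ] ∃[ P ] (fromℕ d ≤ degreeBound C n ε × IsSymmetricTorusPolynomial {n} d P × Approximates ε P (Δ w))

  coarse : ∀ {n w ε} → 0# < ε → 1# ≤ ε * fromℕ 4 → SymmetricApproximation n w ε
  coarse {n} {w} {ε} 0<ε 1≤4ε = 0 , _ ,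
    -- Degree 0 only asks for a nonnegative bound, which holds whatever the values of the logarithms
    -- inside `exp₂` are.
    *≤⇒≤/ 0<ε (≤-respˡ-≈ (sym (zeroˡ ε)) (*-nonNeg (fromℕ-nonNeg 20) (exp₂-nonNeg (C * log₂ (log₂ (fromℕ n / ε)))))) ,
    Deg≤⇒symmetric {f = λ _ → + 1} ¼ (Deg≤-const 0 (+ 1)) ,
    ‖mod1‖≤ {n} (λ x → ¼ * fromℕ 1 - fromBool (Δ w x) / fromℕ 2) (proj₁ 0<ε) (λ x → + 0 , near (Δ w x))
    where
    ¼ = 1# / fromℕ 4
    ¼≤ε : ¼ ≤ ε
    ¼≤ε = ≤*⇒/≤ (0<fromℕ 4) 1≤4ε
    0≤¼ : 0# ≤ ¼
    0≤¼ = *≤⇒≤/ (0<fromℕ 4) (≤-respˡ-≈ (sym (zeroˡ (fromℕ 4))) 0≤1)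
    -¼≤ε : - ¼ ≤ ε
    -¼≤ε = ≤-trans (≤-respʳ-≈ -0#≈0# (neg-anti-≤ 0≤¼)) (proj₁ 0<ε)
    ½≈¼+¼ : ½ ≈ ¼ + ¼
    ½≈¼+¼ = trans (sym (*-identityʳ ½)) (trans (*-congˡ (sym (/-*-cancel {1#} {fromℕ 4} (0<fromℕ 4))))
      (trans (solve 2 (λ h q → h :* (q :* con (+ 4)) := (h :* con (+ 2)) :* (q :+ q)) refl ½ ¼)
      (trans (*-congʳ (/-*-cancel {1#} {fromℕ 2} (0<fromℕ 2))) (*-identityˡ (¼ + ¼)))))
    near : ∀ b → abs (¼ * fromℕ 1 - fromBool b / fromℕ 2 - fromℕ 0) ≤ ε
    near false = abs-≤
      (≤-respˡ-≈ (solve 2 (λ q i → q := q :* con (+ 1) :- con (+ 0) :* i :- con (+ 0)) refl ¼ (fromℕ 2 ⁻¹)) ¼≤ε)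
      (≤-respˡ-≈ (solve 2 (λ q i → :- q := :- (q :* con (+ 1) :- con (+ 0) :* i :- con (+ 0))) refl ¼ (fromℕ 2 ⁻¹)) -¼≤ε)
    near true = abs-≤
      (≤-respˡ-≈ (trans (solve 1 (λ q → :- q := q :* con (+ 1) :- (q :+ q) :- con (+ 0)) refl ¼) value) -¼≤ε)
      (≤-respˡ-≈ (trans (solve 1 (λ q → q := :- (q :* con (+ 1) :- (q :+ q) :- con (+ 0))) refl ¼) (-‿cong value)) ¼≤ε)
      where
      value : ¼ * fromℕ 1 - (¼ + ¼) - fromℕ 0 ≈ ¼ * fromℕ 1 - ½ - fromℕ 0
      value = +-congʳ (+-congˡ (-‿cong (sym ½≈¼+¼)))

  -- From an integer approximation to a torus approximation.

  module _ {n w d e ε} (0≤ε : 0# ≤ ε) (1≤eε : 1# ≤ fromℕ e * ε) .{{_ : ℕ.NonZero e}}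
           (approximation : IntegerApproximation n w d e) where
    open IntegerApproximation approximation

    private
      0<B : 0# < fromℕ B
      0<B = 0<fromℕ B {{B≢0}}
      0<e : 0# < fromℕ e
      0<e = 0<fromℕ e
      β = fromℕ B ⁻¹
      2/2≈1 : ½ * fromℕ 2 ≈ 1#
      2/2≈1 = /-*-cancel {1#} {fromℕ 2} (0<fromℕ 2)

    P/B : Cube n → 𝕋
    P/B x = β * fromℤ (H ∣ x ∣)

    off-value : ∀ y → y ℕ.≤ n → ¬ y ≡ w → fromℕ (r y) / fromℕ B ≤ ε
    off-value y y≤n y≢w = ≤*⇒/≤ 0<B (*-cancelˡ-≤ 0<e (≤-trans
      (≤-respˡ-≈ (fromℕ-* e (r y)) (fromℕ-mono-≤ (off y y≤n y≢w)))
      (linear (*-nonNeg (fromℕ-nonNeg B) (≤⇒0≤ 1≤eε))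
        (solve 3 (λ e ε B → e :* (ε :* B) :- B := B :* (e :* ε :- :1)) refl (fromℕ e) ε (fromℕ B)))))

    on-upper : fromℕ (r w) / fromℕ B ≤ ½
    on-upper = ≤*⇒/≤ 0<B (*-cancelˡ-≤ (0<fromℕ 2) (≤-respˡ-≈ (fromℕ-* 2 (r w)) (≤-respʳ-≈
      (trans (sym (*-identityˡ (fromℕ B))) (trans (*-congʳ (sym 2/2≈1))
        (solve 2 (λ h B → (h :* con (+ 2)) :* B := con (+ 2) :* (h :* B)) refl ½ (fromℕ B))))
      (fromℕ-mono-≤ on-≤))))

    on-lower : ½ - ε ≤ fromℕ (r w) / fromℕ B
    on-lower = *≤⇒≤/ 0<B (*-cancelˡ-≤ (0<fromℕ 2) (linear (≤⇒0≤ B≤)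
      (trans (solve 4 (λ h ε B r → con (+ 2) :* r :- con (+ 2) :* ((h :- ε) :* B)
                := con (+ 2) :* r :+ con (+ 2) :* (ε :* B) :- (h :* con (+ 2)) :* B) refl ½ ε (fromℕ B) (fromℕ (r w)))
        (+-congˡ (-‿cong (trans (*-congʳ 2/2≈1) (*-identityˡ (fromℕ B))))))))
      where
      eB≤ : fromℕ e * fromℕ B ≤ fromℕ 2 * (fromℕ e * fromℕ (r w)) + fromℕ 2 * fromℕ B
      eB≤ = ≤-respˡ-≈ (fromℕ-* e B) (≤-respʳ-≈
        (trans (fromℕ-+ (2 ℕ.* (e ℕ.* r w)) (2 ℕ.* B)) (+-cong
          (trans (fromℕ-* 2 (e ℕ.* r w)) (*-congˡ (fromℕ-* e (r w)))) (fromℕ-* 2 B)))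
        (fromℕ-mono-≤ on-≥))
      B≤ : fromℕ B ≤ fromℕ 2 * fromℕ (r w) + fromℕ 2 * (ε * fromℕ B)
      B≤ = *-cancelˡ-≤ 0<e (linear
        (0≤-+ (≤⇒0≤ eB≤) (*-nonNeg (*-nonNeg (fromℕ-nonNeg 2) (fromℕ-nonNeg B)) (≤⇒0≤ 1≤eε)))
        (solve 4 (λ e B r ε → e :* (con (+ 2) :* r :+ con (+ 2) :* (ε :* B)) :- e :* B
          := ((con (+ 2) :* (e :* r) :+ con (+ 2) :* B) :- e :* B) :+ con (+ 2) :* B :* (e :* ε :- :1))
          refl (fromℕ e) (fromℕ B) (fromℕ (r w)) ε))

    near : ∀ y → y ℕ.≤ n → ∃[ j ] abs (β * fromℤ (H y) - fromBool (does (y ℕ.≟ w)) / fromℕ 2 - fromℤ j) ≤ ε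
    near y y≤n with H≡r y
    ... | j , Hy≡ = j , value (y ℕ.≟ w)
      where
      ρ = fromℕ (r y) / fromℕ B
      0≤ρ : 0# ≤ ρ
      0≤ρ = *-nonNeg (fromℕ-nonNeg (r y)) (⁻¹-nonNeg 0<B)
      -- As H = r + Bj, removing the integer j leaves r/B.
      reduce : ∀ s → β * fromℤ (H y) - s - fromℤ j ≈ ρ - s
      reduce s = begin
        β * fromℤ (H y) - s - fromℤ j
          ≈⟨ +-congʳ (+-congʳ (*-congˡ (trans (reflexive (≡.cong fromℤ Hy≡))
              (trans (fromℤ-+ (+ r y) (+ B ℤ.* j)) (+-congˡ (fromℤ-* (+ B) j)))))) ⟩
        β * (fromℕ (r y) + fromℕ B * fromℤ j) - s - fromℤ j
          ≈⟨ solve 5 (λ β r B s j → β :* (r :+ B :* j) :- s :- j := (r :* β :- s) :+ (B :* β :- :1) :* j)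
              refl β (fromℕ (r y)) (fromℕ B) s (fromℤ j) ⟩
        (ρ - s) + (fromℕ B * β - 1#) * fromℤ j
          ≈⟨ +-congˡ (trans (*-congʳ (trans (+-congʳ (⁻¹-inverse 0<B)) (-‿inverseʳ 1#))) (zeroˡ (fromℤ j))) ⟩
        (ρ - s) + 0#
          ≈⟨ +-identityʳ (ρ - s) ⟩
        ρ - s ∎
        where open SetoidReasoning setoid
      bound : ∀ s → ρ - s ≤ ε → s - ρ ≤ ε → abs (β * fromℤ (H y) - s - fromℤ j) ≤ ε
      bound s upper lower = abs-≤ (≤-respˡ-≈ (sym (reduce s)) upper)
        (≤-respˡ-≈ (trans (solve 2 (λ ρ s → s :- ρ := :- (ρ :- s)) refl ρ s) (-‿cong (sym (reduce s)))) lower)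
      value : (y≟w : Dec (y ≡ w)) → abs (β * fromℤ (H y) - fromBool (does y≟w) / fromℕ 2 - fromℤ j) ≤ ε
      value (yes ≡.refl) = bound (1# / fromℕ 2)
        (≤-trans (linear (≤⇒0≤ on-upper) (solve 2 (λ h ρ → con (+ 0) :- (ρ :- h) := h :- ρ) refl ½ ρ)) 0≤ε)
        (linear (≤⇒0≤ on-lower) (solve 3 (λ h ρ ε → ε :- (h :- ρ) := ρ :- (h :- ε)) refl ½ ρ ε))
      value (no y≢w) = bound (0# / fromℕ 2)
        (≤-respˡ-≈ (solve 2 (λ ρ i → ρ := ρ :- con (+ 0) :* i) refl ρ (fromℕ 2 ⁻¹)) (off-value y y≤n y≢w))
        (≤-trans (linear 0≤ρ (solve 2 (λ ρ i → con (+ 0) :- (con (+ 0) :* i :- ρ) := ρ) refl ρ (fromℕ 2 ⁻¹))) 0≤ε)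

    P/B-approximates : Approximates ε P/B (Δ w)
    P/B-approximates = ‖mod1‖≤ {n} (λ x → P/B x - fromBool (Δ w x) / fromℕ 2) 0≤ε (λ x → near ∣ x ∣ (∣p∣≤n x))

  -- Integer parameters for ε < 1/4 and comparison with the real degree bound.

  ∃⌈1/ε⌉ : ∀ {ε} → 0# < ε → ε < 1# → ∃[ e ] (ℕ.NonZero e × 1# ≤ fromℕ e * ε × fromℕ e * ε ≤ fromℕ 2)
  ∃⌈1/ε⌉ {ε} 0<ε ε<1 =
    let N , 1/ε≤N = archimedean (1# / ε)
    in round (crossing P (λ 1≤0 → 1≰0 (≤-respʳ-≈ (zeroˡ ε) 1≤0)) N (λ ¬p → ¬p (/≤⇒≤* 0<ε 1/ε≤N)))
    where
    P : ℕ → Set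
    P k = ¬ 1# ≤ fromℕ k * ε
    round : ∃[ k ] (P k × ¬ P (suc k)) → ∃[ e ] (ℕ.NonZero e × 1# ≤ fromℕ e * ε × fromℕ e * ε ≤ fromℕ 2)
    -- With kε ≤ 1 and ε ≤ 1, the first multiple (k + 1)ε to reach 1 is at most 2.
    round (k , 1≰kε , ¬¬1≤) = suc k , _ , decidable-stable em ¬¬1≤ ,
      linear (0≤-+ (≤⇒0≤ (proj₁ ε<1)) (≤⇒0≤ (≰⇒≥ 1≰kε)))
        (solve 2 (λ k ε → con (+ 2) :- (:1 :+ k) :* ε := (:1 :- ε) :+ (:1 :- k :* ε)) refl (fromℕ k) ε)

  module _ {n e ε} (1≤n : 1 ℕ.≤ n) (0<ε : 0# < ε) (ε<1 : ε < 1#)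
           (1≤eε : 1# ≤ fromℕ e * ε) (eε≤2 : fromℕ e * ε ≤ fromℕ 2) where

    private
      1≤fn : 1# ≤ fromℕ n
      1≤fn = 1≤fromℕ n {{ℕ.>-nonZero 1≤n}}

      2^k·ε≤n : ℕ → Set
      2^k·ε≤n k = fromℕ (2 ℕ.^ k) * ε ≤ fromℕ n

      2^0·ε≤n : 2^k·ε≤n 0
      2^0·ε≤n = ≤-trans (≤-respˡ-≈ (trans (sym (*-identityˡ ε)) (*-congʳ (sym fromℕ-1))) (proj₁ ε<1)) 1≤fn

      -- Multiplying by e and using 1 ≤ eε would give 2^(ne) ≤ ne.
      2^ne·ε≰n : ¬ 2^k·ε≤n (n ℕ.* e)
      2^ne·ε≰n 2^ne·ε≤n = ℕ.<⇒≱ (n<2^n (n ℕ.* e)) (fromℕ-cancel-≤ (≤-trans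
        (linear (*-nonNeg (fromℕ-nonNeg X) (≤⇒0≤ 1≤eε))
          (solve 3 (λ X e ε → X :* ε :* e :- X := X :* (e :* ε :- :1)) refl (fromℕ X) (fromℕ e) ε))
        (≤-respʳ-≈ (sym (fromℕ-* n e)) (*-monoʳ-≤ (fromℕ e) (fromℕ-nonNeg e) 2^ne·ε≤n))))
        where
        X = 2 ℕ.^ (n ℕ.* e)

    -- Here m is ⌊log(n/ε)⌋. It is at least 2 because n/ε ≥ 4, and eε ≤ 2 turns n/ε ≤ 2^(m + 1) into
    -- the bound on ne, which bounds both n and e by 2^(2 + m).
    ∃⌊log⌋ : ε * fromℕ 4 ≤ 1# → ∃[ m ] (2 ℕ.≤ m × fromℕ (2 ℕ.^ m) * ε ≤ fromℕ n × n ℕ.* e ℕ.≤ 2 ℕ.^ (2 ℕ.+ m))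
    ∃⌊log⌋ 4ε≤1 = floor (crossing 2^k·ε≤n 2^0·ε≤n (n ℕ.* e) 2^ne·ε≰n)
      where
      2≤ : ∀ {m} → ¬ 2^k·ε≤n (suc m) → 2 ℕ.≤ m
      2≤ ¬2^[1+m]ε≤n = ℕ.≮⇒≥ λ m<2 → ¬2^[1+m]ε≤n (≤-trans
        (*-monoʳ-≤ ε (proj₁ 0<ε) (fromℕ-mono-≤ (ℕ.^-monoʳ-≤ 2 m<2)))
        (≤-trans (≤-respˡ-≈ (*-comm ε (fromℕ 4)) 4ε≤1) 1≤fn))
      product≤ : ∀ X → ¬ fromℕ X * ε ≤ fromℕ n → n ℕ.* e ℕ.≤ 2 ℕ.* X
      product≤ X Xε≰n = fromℕ-cancel-≤ (≤-respˡ-≈ (sym (fromℕ-* n e)) (≤-respʳ-≈ (sym (fromℕ-* 2 X)) (≤-trans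
        (*-monoʳ-≤ (fromℕ e) (fromℕ-nonNeg e) (≰⇒≥ Xε≰n))
        (linear (*-nonNeg (fromℕ-nonNeg X) (≤⇒0≤ eε≤2))
          (solve 3 (λ X e ε → con (+ 2) :* X :- X :* ε :* e := X :* (con (+ 2) :- e :* ε)) refl (fromℕ X) (fromℕ e) ε)))))
      floor : ∃[ m ] (2^k·ε≤n m × ¬ 2^k·ε≤n (suc m)) →
              ∃[ m ] (2 ℕ.≤ m × fromℕ (2 ℕ.^ m) * ε ≤ fromℕ n × n ℕ.* e ℕ.≤ 2 ℕ.^ (2 ℕ.+ m))
      floor (m , 2^mε≤n , 2^[1+m]ε≰n) = m , 2≤ 2^[1+m]ε≰n , 2^mε≤n , product≤ (2 ℕ.^ suc m) 2^[1+m]ε≰n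

    -- Nested floors replace the real logarithms: m for log(n/ε) and b for log m. Then 2^b ≤ m ≤ L
    -- gives 2^(20b) ≤ `pow L C`, and eε ≤ 2 cancels the factor 2 in front of d.
    ≤-degreeBound : ∀ {m d} → 2 ℕ.≤ m → fromℕ (2 ℕ.^ m) * ε ≤ fromℕ n →
      (∀ {b} → 1 ℕ.≤ b → m ℕ.< 2 ℕ.^ suc b → 2 ℕ.* d ℕ.≤ 2 ℕ.^ (20 ℕ.* b) ℕ.* e) → fromℕ d ≤ degreeBound C n ε
    ≤-degreeBound {m} {d} 2≤m 2^mε≤n 2d≤ =
      *≤⇒≤/ 0<ε (bound (crossing (λ k → 2 ℕ.^ k ℕ.≤ m) (ℕ.<⇒≤ 2≤m) m (ℕ.<⇒≱ (n<2^n m))))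
      where
      L = log₂ (fromℕ n / ε)
      m≤L : fromℕ m ≤ L
      m≤L = ≤-log₂ m (≤-respˡ-≈ (fromℕ-^ 2 m) (*≤⇒≤/ 0<ε 2^mε≤n))
      dε≤ : ∀ Y → 2 ℕ.* d ℕ.≤ Y ℕ.* e → fromℕ d * ε ≤ fromℕ Y
      dε≤ Y 2d≤Ye = *-cancelˡ-≤ (0<fromℕ 2) (≤-trans
        (≤-respˡ-≈ (trans (*-congʳ (fromℕ-* 2 d)) (*-assoc (fromℕ 2) (fromℕ d) ε))
          (*-monoʳ-≤ ε (proj₁ 0<ε) (fromℕ-mono-≤ 2d≤Ye)))
        (≤-respˡ-≈ (sym (*-congʳ (fromℕ-* Y e))) (linear (*-nonNeg (fromℕ-nonNeg Y) (≤⇒0≤ eε≤2))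
          (solve 3 (λ Y e ε → con (+ 2) :* Y :- Y :* e :* ε := Y :* (con (+ 2) :- e :* ε)) refl (fromℕ Y) (fromℕ e) ε))))
      pow≤C*pow : pow L C ≤ C * pow L C
      pow≤C*pow = ≤-respˡ-≈ (*-identityˡ (pow L C)) (*-monoʳ-≤ (pow L C) (exp₂-nonNeg (C * log₂ L)) (1≤fromℕ 20))
      bound : ∃[ b ] (2 ℕ.^ b ℕ.≤ m × ¬ 2 ℕ.^ suc b ℕ.≤ m) → fromℕ d * ε ≤ C * pow L C
      bound (b , 2^b≤m , 2^[1+b]≰m) = ≤-trans
        (dε≤ (2 ℕ.^ (20 ℕ.* b)) (2d≤ 1≤b (ℕ.≰⇒> 2^[1+b]≰m)))
        (≤-trans (≤-pow b 20 (≤-trans (fromℕ-mono-≤ 2^b≤m) m≤L)) pow≤C*pow)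
        where
        1≤b : 1 ℕ.≤ b
        1≤b = ℕ.≮⇒≥ λ b<1 → 2^[1+b]≰m (ℕ.≤-trans (ℕ.^-monoʳ-≤ 2 b<1) 2≤m)

  -- Each intermediate existential is consumed by pattern matching, so that the
  -- witnesses stay variables: unfolded, the degree is a huge unary numeral.
  fine : ∀ {n w ε} → 1 ℕ.≤ n → w ℕ.≤ n → 0# < ε → ε < 1# → ε * fromℕ 4 ≤ 1# → SymmetricApproximation n w ε
  fine {n} {w} {ε} 1≤n w≤n 0<ε ε<1 4ε≤1 = with-e (∃⌈1/ε⌉ 0<ε ε<1)
    where
    Integers : ℕ → ℕ → Set
    Integers e m = ∃[ d ] (IntegerApproximation n w d e ×
      (∀ {b} → 1 ℕ.≤ b → m ℕ.< 2 ℕ.^ suc b → 2 ℕ.* d ℕ.≤ 2 ℕ.^ (20 ℕ.* b) ℕ.* e))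

    integers : ∀ {e m} → ℕ.NonZero e → n ℕ.* e ℕ.≤ 2 ℕ.^ (2 ℕ.+ m) → Integers e m
    integers {e} {m} e≢0 ne≤ = degree (3 ℕ.+ m) e ,
      integerApproximation w≤n {{e≢0}} (ℕ.m≤m+n 2 m)
        (ℕ.≤-trans (ℕ.m≤m*n n e {{e≢0}}) ne≤)
        (ℕ.≤-trans (ℕ.m≤n*m e n {{ℕ.>-nonZero 1≤n}}) ne≤) ,
      2*degree≤ {e = e}

    module _ {e} (e≢0 : ℕ.NonZero e) (1≤eε : 1# ≤ fromℕ e * ε) (eε≤2 : fromℕ e * ε ≤ fromℕ 2) where

      with-d : ∀ {m} → 2 ℕ.≤ m → fromℕ (2 ℕ.^ m) * ε ≤ fromℕ n → Integers e m → SymmetricApproximation n w ε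
      with-d 2≤m 2^mε≤n (d , approximation , 2d≤) = d , P/B (proj₁ 0<ε) 1≤eε {{e≢0}} approximation ,
        ≤-degreeBound {n} {e} 1≤n 0<ε ε<1 1≤eε eε≤2 {d = d} 2≤m 2^mε≤n 2d≤ ,
        Deg≤⇒symmetric {f = IntegerApproximation.H approximation}
          (fromℕ (IntegerApproximation.B approximation) ⁻¹) (IntegerApproximation.deg approximation) ,
        P/B-approximates (proj₁ 0<ε) 1≤eε {{e≢0}} approximation

      with-m : ∃[ m ] (2 ℕ.≤ m × fromℕ (2 ℕ.^ m) * ε ≤ fromℕ n × n ℕ.* e ℕ.≤ 2 ℕ.^ (2 ℕ.+ m)) → SymmetricApproximation n w ε
      with-m (m , 2≤m , 2^mε≤n , ne≤) = with-d 2≤m 2^mε≤n (integers e≢0 ne≤)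

    with-e : ∃[ e ] (ℕ.NonZero e × 1# ≤ fromℕ e * ε × fromℕ e * ε ≤ fromℕ 2) → SymmetricApproximation n w ε
    with-e (e , e≢0 , 1≤eε , eε≤2) = with-m e≢0 1≤eε eε≤2 (∃⌊log⌋ {n} {e} 1≤n 0<ε ε<1 1≤eε eε≤2 4ε≤1)

  -- Combining the two cases and passing to the minimal degree.

  symmetricApproximation : ∀ n w → 1 ℕ.≤ n → w ℕ.≤ n → ∀ ε → 0# < ε → ε < 1# → SymmetricApproximation n w ε
  symmetricApproximation n w 1≤n w≤n ε 0<ε ε<1 with total 1# (ε * fromℕ 4)
  ... | inj₁ 1≤4ε = coarse {n} {w} 0<ε 1≤4ε
  ... | inj₂ 4ε≤1 = fine {n} {w} 1≤n w≤n 0<ε ε<1 4ε≤1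

  toroidalDegree-≤ : ∀ {n ε d P} {f : Cube n → Bool} {u} → fromℕ d ≤ u →
    IsSymmetricTorusPolynomial d P → Approximates ε P f → ∃[ d′ ] (IsToroidalDegree ε f d′ × fromℕ d′ ≤ u)
  toroidalDegree-≤ {ε = ε} {P = P} {f = f} d≤u (c , _ , P≡) approximates
    with least {P = HasApproximation ε f} (P , (c , P≡) , approximates)
  ... | d′ , d′≤d , approximation , minimal = d′ , (approximation , minimal) , ≤-trans (fromℕ-mono-≤ d′≤d) d≤u

  withToroidalDegree : ∀ {n w ε} → SymmetricApproximation n w ε →
    SymmetricApproximation n w ε × (∃[ d ] (IsToroidalDegree {n} ε (Δ w) d × fromℕ d ≤ degreeBound C n ε))
  withToroidalDegree a@(d , P , d≤ , symmetric , approximates) = a , toroidalDegree-≤ d≤ symmetric approximates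

lemma4p1 : (em : ExcludedMiddle 0ℓ) (R : CompleteOrderedField) →
    let open Torus em R in
    ∃[ C ] (0# < C ×
    (∀ (n w : ℕ) → 1 ℕ.≤ n → w ℕ.≤ n → ∀ (ε : ℝ) → 0# < ε → ε < 1# →
    (∃[ d ] ∃[ P ] (fromℕ d ≤ degreeBound C n ε
    × IsSymmetricTorusPolynomial {n} d P
    × Approximates ε P (Δ w)))
    × (∃[ d ] (IsToroidalDegree {n} ε (Δ w) d
    × fromℕ d ≤ degreeBound C n ε))))
lemma4p1 em R = C , 0<fromℕ 20 , λ n w 1≤n w≤n ε 0<ε ε<1 →
  withToroidalDegree (symmetricApproximation n w 1≤n w≤n ε 0<ε ε<1)
  where open Reals em R
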